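{- Let $3\leq g<n$ and let $G$ be a unicyclic graph on $n$ vertices with girth $g$. Then $F(G)\geq F(U_{n,g}^l)$, with equality if and only if $G$ is isomorphic to $U_{n,g}^l$. Moreover, $$F(U_{n,g}^l)=\left(\frac{n-g}{2}\right)(n+g^2+3)+g^2+1.$$
   Context: All graphs are finite, simple and undirected. A unicyclic graph is a connected graph with the same number of vertices and edges; its girth is the length of its unique cycle. The lollipop graph $U_{n,g}^l$ ($3\leq g<n$) is obtained from the cycle $C_g$ and a path on $n-g+1$ vertices by identifying one end vertex of the path with a vertex of the cycle. A connected subgraph of a graph $G=(V,E)$ is a graph $(V',E')$ with $\emptyset\neq V'\subseteq V$, $E'\subseteq E$, every edge of $E'$ having both endpoints in $V'$, and $(V',E')$ connected; distinct pairs $(V',E')$ are counted separately. The core index $F(G)$ is the number of connected subgraphs of $G$. -}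

module Defs where

open import Data.Nat using (ℕ; zero; suc; _+_; _*_; _∸_; _≤_; _<_; _≡ᵇ_; _<ᵇ_)
open import Data.Bool using (Bool; true; false; _∧_; _∨_; not; if_then_else_)
open import Data.Fin using (Fin; toℕ)
open import Data.Fin.Properties using (_≟_)
open import Data.Vec using (Vec; []; _∷_; lookup; replicate; tabulate)
open import Data.List using (List; []; _∷_; _++_; map; filter; length; concatMap; allFin)
open import Data.Bool.ListAction using (any; all)
open import Data.Product using (Σ; _×_; _,_; proj₁; proj₂)
open import Data.Maybe using (Maybe; just; nothing)
open import Relation.Nullary using (¬_)
open import Relation.Nullary.Decidable using (⌊_⌋)
open import Relation.Binary.PropositionalEquality using (_≡_)
open import Data.Bool.Properties using (T?)
open import Function using (Injective)
open import Function.Bundles using (_↔_; Inverse)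

Graph : ℕ → Set
Graph n = Fin n → Fin n → Bool

IsSimple : ∀ {n} → Graph n → Set
IsSimple {n} G = (∀ (i j : Fin n) → G i j ≡ G j i) × (∀ (i : Fin n) → G i i ≡ false)

_==_ : ∀ {n} → Fin n → Fin n → Bool
i == j = ⌊ i ≟ j ⌋

edges : ∀ {n} → Graph n → List (Fin n × Fin n)
edges {n} G = concatMap (λ i → concatMap (λ j →
                 if (toℕ i <ᵇ toℕ j) ∧ G i j then (i , j) ∷ [] else []) (allFin n)) (allFin n)

allSubsets : (n : ℕ) → List (Vec Bool n)
allSubsets zero = [] ∷ []
allSubsets (suc n) = map (true ∷_) (allSubsets n) ++ map (false ∷_) (allSubsets n)

-- all sub-lists (by position) of a list; for a duplicate-free list these
-- are exactly all subsets, each listed once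
sublists : ∀ {A : Set} → List A → List (List A)
sublists [] = [] ∷ []
sublists (x ∷ xs) = map (x ∷_) (sublists xs) ++ sublists xs

firstIn : ∀ {n} → Vec Bool n → Maybe (Fin n)
firstIn {n} V = go (allFin n)
  where
  go : List (Fin n) → Maybe (Fin n)
  go [] = nothing
  go (i ∷ is) = if lookup V i then just i else go is

step : ∀ {n} → List (Fin n × Fin n) → Vec Bool n → Vec Bool n
step {n} E R = tabulate λ v → lookup R v ∨
  any (λ e → (lookup R (proj₁ e) ∧ (proj₂ e == v)) ∨ (lookup R (proj₂ e) ∧ (proj₁ e == v))) E

iter : ℕ → ∀ {A : Set} → (A → A) → A → A
iter zero f a = a
iter (suc k) f a = f (iter k f a)

-- set of vertices reachable from x using edges of E' (n iterations suffice)
reach : ∀ {n} → List (Fin n × Fin n) → Fin n → Vec Bool n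
reach {n} E x = iter n (step E) (tabulate (λ v → x == v))

-- (V', E') is a connected subgraph of G:
--   V' nonempty, E' ⊆ E(G) (guaranteed by enumeration), endpoints of E'
--   in V', and every vertex of V' reachable from a fixed vertex of V'
isConnectedSub : ∀ {n} → Vec Bool n → List (Fin n × Fin n) → Bool
isConnectedSub {n} V E with firstIn V
... | nothing = false
... | just x  = all (λ e → lookup V (proj₁ e) ∧ lookup V (proj₂ e)) E
              ∧ all (λ v → not (lookup V v) ∨ lookup (reach E x) v) (allFin n)

F : ∀ {n} → Graph n → ℕ
F {n} G = length (filter (λ p → T? (isConnectedSub (proj₁ p) (proj₂ p)))
            (concatMap (λ V → map (V ,_) (sublists (edges G))) (allSubsets n)))

Connected : ∀ {n} → Graph n → Set
Connected {n} G = isConnectedSub (replicate n true) (edges G) ≡ true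

HasCycle : ∀ {n} → Graph n → ℕ → Set
HasCycle {n} G k = 3 ≤ k × Σ (Fin k → Fin n) λ c → Injective _≡_ _≡_ c ×
  ((∀ i j → suc (toℕ i) ≡ toℕ j → G (c i) (c j) ≡ true) ×
   (∀ i j → toℕ i ≡ k ∸ 1 → toℕ j ≡ 0 → G (c i) (c j) ≡ true))

Unicyclic : ∀ {n} → Graph n → Set
Unicyclic {n} G = Connected G × length (edges G) ≡ n

Girth : ∀ {n} → Graph n → ℕ → Set
Girth G g = HasCycle G g × (∀ k → k < g → ¬ HasCycle G k)

_≅_ : ∀ {n} → Graph n → Graph n → Set
_≅_ {n} G H = Σ (Fin n ↔ Fin n) λ f →
  ∀ i j → G i j ≡ H (Inverse.to f i) (Inverse.to f j)

-- Lollipop U^l_{n,g}: path 0 - 1 - … - (n-1) plus the edge {0, g-1}.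
-- The cycle is 0,1,…,g-1 and the pendant path g-1,…,n-1 has n-g+1 vertices.

lollipop : (n g : ℕ) → Graph n
lollipop n g i j = not (i == j) ∧
  ((suc (toℕ i) ≡ᵇ toℕ j) ∨ (suc (toℕ j) ≡ᵇ toℕ i) ∨
   ((toℕ i ≡ᵇ 0) ∧ (toℕ j ≡ᵇ g ∸ 1)) ∨ ((toℕ j ≡ᵇ 0) ∧ (toℕ i ≡ᵇ g ∸ 1)))

{-# OPTIONS --safe #-}
-- A unicyclic graph of girth g is the graph of a function p, with one edge {v , p v} per vertex: on the
-- cycle p is the successor and off it p steps towards the cycle.  A subgraph is then a vertex set V with
-- the set S ⊆ V of vertices whose edge is used, and a connected one has at most one sink, a vertex of
-- V ∖ S.  For the lower bound, call the m = n − g vertices off the cycle tails.  Each tail u yields one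
-- subgraph for each of the g(g+1)/2 + 1 connected subgraphs of the cycle through the entry point of u; each
-- unordered pair of tails yields one more, their path if they are comparable under p and the union of
-- their forward orbits otherwise; the cycle itself contributes g² + 1.  If two tails are incomparable,
-- the spanning tree obtained by deleting a cycle edge has not been counted.  If all are comparable, G is
-- a lollipop; numbering its vertices so that p subtracts one, a connected subgraph is the union of an
-- interval and a possibly empty initial segment, which gives the matching upper bound.
module Submission where

open import Defs
open import Data.Bool using (Bool; true; false; _∧_; _∨_; not; if_then_else_; T) renaming (_≟_ to _≟ᵇ_)
open import Data.Bool.ListAction using (any; all)
open import Data.Bool.Properties using (T-≡)
open import Data.Fin using (Fin; zero; suc; toℕ; fromℕ<; inject₁)
open import Data.Fin.Properties using (_≟_; any?; toℕ-injective; toℕ<n; toℕ-fromℕ<; toℕ-inject₁; fromℕ<-toℕ; injective⇒≤)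
open import Data.Fin.Subset using (∣_∣)
open import Data.Fin.Subset.Properties using (∣p∣≤n; p⊂q⇒∣p∣<∣q∣)
open import Data.List using (List; []; _∷_; _++_; map; filter; length; concatMap; allFin; applyUpTo; upTo; cartesianProduct)
open import Data.List.Membership.Propositional using (_∈_; _∉_; find; lose)
open import Data.List.Membership.Propositional.Properties using (∈-map⁺; ∈-map⁻; ∈-++⁺ˡ; ∈-++⁺ʳ; ∈-++⁻; ∈-∃++; ∈-concatMap⁺; ∈-concatMap⁻; ∈-filter⁺; ∈-filter⁻; ∈-allFin; ∈-applyUpTo⁺; ∈-applyUpTo⁻; ∈-upTo⁺; ∈-upTo⁻; ∈-cartesianProduct⁺; ∈-cartesianProduct⁻)
open import Data.List.Properties using (length-++; length-map; length-tabulate; length-applyUpTo; length-upTo; filter-≐)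
open import Data.List.Relation.Unary.All using (All; []; _∷_)
import Data.List.Relation.Unary.All as All
open import Data.List.Relation.Unary.AllPairs using (AllPairs; []; _∷_)
import Data.List.Relation.Unary.AllPairs as AllPairs
import Data.List.Relation.Unary.AllPairs.Properties as AllPairsP
open import Data.List.Relation.Unary.Any using (here; there)
open import Data.List.Relation.Unary.Unique.Propositional using (Unique)
import Data.List.Relation.Unary.Unique.Propositional.Properties as UniqueP
open import Data.Maybe using (Maybe; just; nothing)
import Data.Maybe.Properties as MaybeP
open import Data.Nat using (ℕ; zero; suc; _+_; _*_; _∸_; _≤_; _<_; _≡ᵇ_; _<ᵇ_; z≤n; s≤s; _≤?_; _<?_)
open import Data.Nat.Induction using (<-rec)
open import Data.Nat.Properties hiding (_≟_)
open import Data.Nat.Tactic.RingSolver using (solve-∀)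
open import Data.Product using (Σ; ∃; ∃₂; _×_; _,_; proj₁; proj₂; map₂)
open import Data.Sum using (_⊎_; inj₁; inj₂)
open import Data.Vec using (Vec; lookup; replicate; tabulate)
import Data.Vec as Vec
open import Data.Vec.Properties using (lookup∘tabulate; tabulate∘lookup; tabulate-cong; lookup-replicate; lookup⇒[]=; []=⇒lookup)
import Data.Vec.Properties as VecP
open import Function using (_∘_; id)
open import Function.Bundles using (_⇔_; mk⇔; Equivalence; Inverse; mk↔ₛ′)
open import Function.Construct.Identity using (↔-id)
open import Relation.Binary.PropositionalEquality using (_≡_; _≢_; refl; sym; trans; cong; cong₂; subst; subst₂; module ≡-Reasoning)
open import Relation.Nullary using (¬_; Dec; yes; no; contradiction)
open import Relation.Nullary.Decidable using (⌊_⌋; map′; ¬?; _×-dec_; _⊎-dec_)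
open import Relation.Unary using (Decidable)
import Data.List.Membership.DecPropositional as DecMembership
import Data.Product.Properties as ProductP
open import Relation.Binary.Definitions using (tri<; tri≈; tri>)

-- Counting with duplicate-free lists

-- The two counts split the same number differently. With m = n - g the lower bound is (m + 1)(g(g +
-- 1)/2 + 1) + g(g - 1)/2 + m(m + 1)/2. Its first term has the factor m + 1 because a base vertex
-- `o` of the cycle is treated as a tail of length zero: of the g² + 1 connected subgraphs of the
-- cycle, those through `o` are its share, and the g(g - 1)/2 paths avoiding `o` form the second
-- term. The upper bound is n(n + 1)/2 + (m + 1)(g(g - 1)/2 + 1), one term for single intervals and
-- one with a factor for the m + 1 possible highest vertices. All values are doubled, so that no
-- halves occur. Connectedness is handled without walks: a property that passes both ways along
-- every chosen edge is constant on V. Choosing the property well, for instance that of draining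
-- into a given sink, replaces inductions along paths. An isomorphism with the lollipop transports
-- the numbering of the vertices, and both bounds are then applied to G itself.

length-⊆ : ∀ {A : Set} {xs ys : List A} → Unique xs → (∀ {x} → x ∈ xs → x ∈ ys) → length xs ≤ length ys
length-⊆ [] _ = z≤n
-- One occurrence of `x` is cut out of `ys`; the remaining `xs` still embed, since `x` does not
-- recur among them.
length-⊆ {xs = x ∷ xs} (x∉xs ∷ u) sub with ∈-∃++ (sub (here refl))
... | as , bs , refl = begin
  suc (length xs)              ≤⟨ s≤s (length-⊆ u sub′) ⟩
  suc (length (as ++ bs))      ≡⟨ cong suc (length-++ as) ⟩
  suc (length as + length bs)  ≡⟨ +-suc (length as) (length bs) ⟨
  length as + suc (length bs)  ≡⟨ length-++ as ⟨
  length (as ++ x ∷ bs)        ∎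
  where
  open ≤-Reasoning
  sub′ : ∀ {y} → y ∈ xs → y ∈ as ++ bs
  sub′ y∈ with ∈-++⁻ as (sub (there y∈))
  ... | inj₁ y∈as = ∈-++⁺ˡ y∈as
  ... | inj₂ (here refl) = contradiction refl (All.lookup x∉xs y∈)
  ... | inj₂ (there y∈bs) = ∈-++⁺ʳ as y∈bs

concatMap-unique : ∀ {A B : Set} (f : A → List B) → (∀ x → Unique (f x)) →
  (∀ {x y z} → z ∈ f x → z ∈ f y → x ≡ y) → ∀ {xs} → Unique xs → Unique (concatMap f xs)
concatMap-unique f uf inj [] = []
concatMap-unique f uf inj {x ∷ xs} (x∉ ∷ u) = UniqueP.++⁺ (uf x) (concatMap-unique f uf inj u) disj
  where
  disj : ∀ {z} → ¬ (z ∈ f x × z ∈ concatMap f xs)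
  disj (zx , z∈) with find (∈-concatMap⁻ f {xs = xs} z∈)
  ... | y , y∈ , zy = All.lookup x∉ y∈ (inj zx zy)

-- Unordered pairs with repetition, k(k + 1)/2 of them for k entries. They serve as pairs of tails
-- and, over `upTo k`, as intervals.
pairs : ∀ {A : Set} → List A → List (A × A)
pairs [] = []
pairs (x ∷ xs) = map (x ,_) (x ∷ xs) ++ pairs xs

length-pairs : ∀ {A : Set} (xs : List A) → 2 * length (pairs xs) ≡ length xs * suc (length xs)
length-pairs [] = refl
length-pairs (x ∷ xs)
  rewrite length-++ (map (x ,_) xs) {pairs xs} | length-map (x ,_) xs = begin
  2 * suc (length xs + length (pairs xs))                   ≡⟨ expand (length xs) (length (pairs xs)) ⟩
  2 * suc (length xs) + 2 * length (pairs xs)               ≡⟨ cong (2 * suc (length xs) +_) (length-pairs xs) ⟩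
  2 * suc (length xs) + length xs * suc (length xs)         ≡⟨ collect (length xs) ⟩
  suc (length xs) * suc (suc (length xs))                   ∎
  where
  open ≡-Reasoning
  expand : ∀ a b → 2 * suc (a + b) ≡ 2 * suc a + 2 * b
  expand = solve-∀
  collect : ∀ a → 2 * suc a + a * suc a ≡ suc a * suc (suc a)
  collect = solve-∀

∈-pairs⁻ : ∀ {A : Set} (xs : List A) {a b} → (a , b) ∈ pairs xs → a ∈ xs × b ∈ xs
∈-pairs⁻ (x ∷ xs) ab∈ with ∈-++⁻ (map (x ,_) (x ∷ xs)) ab∈
... | inj₂ ab∈′ = there (proj₁ (∈-pairs⁻ xs ab∈′)) , there (proj₂ (∈-pairs⁻ xs ab∈′))
... | inj₁ ab∈′ with ∈-map⁻ (x ,_) ab∈′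
... | _ , b∈ , refl = here refl , b∈

∈-pairs⁺ : ∀ {A : Set} {xs : List A} {a b} → a ∈ xs → b ∈ xs → (a , b) ∈ pairs xs ⊎ (b , a) ∈ pairs xs
∈-pairs⁺ (here refl) b∈ = inj₁ (∈-++⁺ˡ (∈-map⁺ _ b∈))
∈-pairs⁺ (there a∈) (here refl) = inj₂ (∈-++⁺ˡ (∈-map⁺ _ (there a∈)))
∈-pairs⁺ {xs = x ∷ xs} (there a∈) (there b∈) with ∈-pairs⁺ a∈ b∈
... | inj₁ p = inj₁ (∈-++⁺ʳ (map (x ,_) (x ∷ xs)) p)
... | inj₂ p = inj₂ (∈-++⁺ʳ (map (x ,_) (x ∷ xs)) p)

infix 4 _≋_
_≋_ : ∀ {A : Set} → A × A → A × A → Set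
(a , b) ≋ (c , d) = (a ≡ c × b ≡ d) ⊎ (a ≡ d × b ≡ c)

pairs-distinct : ∀ {A : Set} {xs : List A} → Unique xs → AllPairs (λ p q → ¬ (p ≋ q)) (pairs xs)
pairs-distinct [] = []
pairs-distinct {xs = x ∷ xs} u@(x∉ ∷ u′) = AllPairsP.++⁺
  (AllPairsP.map⁺ (AllPairs.map (λ y≢z → λ { (inj₁ (_ , eq)) → y≢z eq ; (inj₂ (eq , eq′)) → y≢z (trans eq′ eq) }) u))
  (pairs-distinct u′)
  (All.tabulate λ p∈ → All.tabulate λ q∈ → apart p∈ q∈)
  where
  apart : ∀ {p q} → p ∈ map (x ,_) (x ∷ xs) → q ∈ pairs xs → ¬ (p ≋ q)
  apart p∈ q∈ p≋q with ∈-map⁻ (x ,_) p∈ | ∈-pairs⁻ xs q∈ | p≋q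
  ... | _ , _ , refl | c∈ , _ | inj₁ (refl , _) = All.lookup x∉ c∈ refl
  ... | _ , _ , refl | _ , d∈ | inj₂ (refl , _) = All.lookup x∉ d∈ refl

pairs-upTo⁻ : ∀ k {i j} → (i , j) ∈ pairs (upTo k) → i ≤ j × j < k
pairs-upTo⁻ k {i} {j} ij∈ = sorted (upTo k) increasing ij∈ , ∈-upTo⁻ (proj₂ (∈-pairs⁻ (upTo k) ij∈))
  where
  increasing : AllPairs _<_ (upTo k)
  increasing = AllPairsP.applyUpTo⁺₁ id k (λ i<j _ → i<j)
  sorted : ∀ xs → AllPairs _<_ xs → (i , j) ∈ pairs xs → i ≤ j
  sorted (x ∷ xs) (x< ∷ inc) ij∈ with ∈-++⁻ (map (x ,_) (x ∷ xs)) ij∈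
  ... | inj₂ ij∈′ = sorted xs inc ij∈′
  ... | inj₁ ij∈′ with ∈-map⁻ (x ,_) ij∈′
  ... | _ , here refl , refl = ≤-refl
  ... | _ , there j∈ , refl = <⇒≤ (All.lookup x< j∈)

pairs-upTo⁺ : ∀ {k i j} → i ≤ j → j < k → (i , j) ∈ pairs (upTo k)
pairs-upTo⁺ {k} {i} {j} i≤j j<k with ∈-pairs⁺ (∈-upTo⁺ (≤-<-trans i≤j j<k)) (∈-upTo⁺ j<k)
... | inj₁ ij∈ = ij∈
-- Listed the other way round, the pair satisfies both inequalities, so its entries coincide.
... | inj₂ ji∈ with ≤-antisym i≤j (proj₁ (pairs-upTo⁻ k ji∈))
... | refl = ji∈

-- Enumerating subgraphs

∈-allSubsets : ∀ {n} (V : Vec Bool n) → V ∈ allSubsets n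
∈-allSubsets Vec.[] = here refl
∈-allSubsets {suc n} (true Vec.∷ V) = ∈-++⁺ˡ (∈-map⁺ _ (∈-allSubsets V))
∈-allSubsets {suc n} (false Vec.∷ V) = ∈-++⁺ʳ (map (true Vec.∷_) (allSubsets n)) (∈-map⁺ _ (∈-allSubsets V))

allSubsets-unique : ∀ n → Unique (allSubsets n)
allSubsets-unique zero = [] ∷ []
allSubsets-unique (suc n) = UniqueP.++⁺
  (UniqueP.map⁺ VecP.∷-injectiveʳ (allSubsets-unique n)) (UniqueP.map⁺ VecP.∷-injectiveʳ (allSubsets-unique n)) disj
  where
  disj : ∀ {V} → ¬ (V ∈ map (true Vec.∷_) (allSubsets n) × V ∈ map (false Vec.∷_) (allSubsets n))
  disj (t , f) with ∈-map⁻ _ t | ∈-map⁻ _ f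
  ... | _ , _ , refl | _ , _ , ()

sublists-⊆ : ∀ {A : Set} (xs : List A) {E e} → E ∈ sublists xs → e ∈ E → e ∈ xs
sublists-⊆ [] (here refl) ()
sublists-⊆ (x ∷ xs) E∈ e∈ with ∈-++⁻ (map (x ∷_) (sublists xs)) E∈
... | inj₂ E∈′ = there (sublists-⊆ xs E∈′ e∈)
... | inj₁ E∈′ with ∈-map⁻ (x ∷_) E∈′ | e∈
... | _ , _ , refl | here refl = here refl
... | _ , E∈″ , refl | there e∈′ = there (sublists-⊆ xs E∈″ e∈′)

sublists-unique : ∀ {A : Set} {xs : List A} → Unique xs → Unique (sublists xs)
sublists-unique [] = [] ∷ []
sublists-unique {xs = x ∷ xs} (x∉ ∷ u) = UniqueP.++⁺
  (UniqueP.map⁺ (λ { refl → refl }) (sublists-unique u)) (sublists-unique u) disj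
  where
  disj : ∀ {E} → ¬ (E ∈ map (x ∷_) (sublists xs) × E ∈ sublists xs)
  disj (a , b) with ∈-map⁻ (x ∷_) a
  ... | _ , _ , refl = All.lookup x∉ (sublists-⊆ xs b (here refl)) refl

filter-∈-sublists : ∀ {A : Set} {P : A → Set} (P? : Decidable P) xs → filter P? xs ∈ sublists xs
filter-∈-sublists P? [] = here refl
filter-∈-sublists P? (x ∷ xs) with P? x
... | yes _ = ∈-++⁺ˡ (∈-map⁺ (x ∷_) (filter-∈-sublists P? xs))
... | no _ = ∈-++⁺ʳ (map (x ∷_) (sublists xs)) (filter-∈-sublists P? xs)

-- In a duplicate-free list a sublist is determined by its elements. This allows an edge set to be
-- given by a property of edges.
sublist≡filter : ∀ {A : Set} {P : A → Set} (P? : Decidable P) {xs E : List A} → Unique xs → E ∈ sublists xs →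
  (∀ {e} → e ∈ E → P e) → (∀ {e} → e ∈ xs → P e → e ∈ E) → E ≡ filter P? xs
sublist≡filter P? {[]} _ (here refl) _ _ = refl
sublist≡filter P? {x ∷ xs} {E} (x∉ ∷ u) E∈ ⊆P P⊆ with ∈-++⁻ (map (x ∷_) (sublists xs)) E∈
sublist≡filter P? {x ∷ xs} {E} (x∉ ∷ u) E∈ ⊆P P⊆ | inj₂ E∈′ with P? x
... | yes px = contradiction refl (All.lookup x∉ (sublists-⊆ xs E∈′ (P⊆ (here refl) px)))
... | no _ = sublist≡filter P? u E∈′ ⊆P (P⊆ ∘ there)
sublist≡filter P? {x ∷ xs} {E} (x∉ ∷ u) E∈ ⊆P P⊆ | inj₁ E∈′ with ∈-map⁻ (x ∷_) E∈′
... | E′ , E′∈ , refl with P? x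
... | no ¬px = contradiction (⊆P (here refl)) ¬px
... | yes _ = cong (x ∷_) (sublist≡filter P? u E′∈ (⊆P ∘ there) P⊆′)
  where
  P⊆′ : ∀ {e} → e ∈ xs → _ → e ∈ E′
  P⊆′ e∈ pe with P⊆ (there e∈) pe
  ... | here refl = contradiction refl (All.lookup x∉ e∈)
  ... | there e∈′ = e∈′

module _ {n} (G : Graph n) where

  private
    cell : Fin n → Fin n → List (Fin n × Fin n)
    cell i j = if (toℕ i <ᵇ toℕ j) ∧ G i j then (i , j) ∷ [] else []

    ∈-cell⁻ : ∀ i j {e} → e ∈ cell i j → e ≡ (i , j) × toℕ i < toℕ j × G i j ≡ true
    ∈-cell⁻ i j e∈ with toℕ i <ᵇ toℕ j in lt | G i j
    ∈-cell⁻ i j (here refl) | true | true = refl , <ᵇ⇒< _ _ (subst T (sym lt) _) , refl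

    ∈-cell⁺ : ∀ i j → toℕ i < toℕ j → G i j ≡ true → (i , j) ∈ cell i j
    ∈-cell⁺ i j lt adj rewrite adj with toℕ i <ᵇ toℕ j | <⇒<ᵇ lt
    ... | true | _ = here refl

    row : Fin n → List (Fin n × Fin n)
    row i = concatMap (cell i) (allFin n)

    ∈-row⁻ : ∀ i {e} → e ∈ row i → proj₁ e ≡ i × toℕ i < toℕ (proj₂ e) × G i (proj₂ e) ≡ true
    ∈-row⁻ i e∈ with find (∈-concatMap⁻ (cell i) {xs = allFin n} e∈)
    ... | j , _ , e∈′ with ∈-cell⁻ i j e∈′
    ... | refl , lt , adj = refl , lt , adj

  ∈-edges⁻ : ∀ {i j} → (i , j) ∈ edges G → toℕ i < toℕ j × G i j ≡ true
  ∈-edges⁻ e∈ with find (∈-concatMap⁻ row {xs = allFin n} e∈)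
  ... | i , _ , e∈′ with ∈-row⁻ i e∈′
  ... | refl , lt , adj = lt , adj

  ∈-edges⁺ : ∀ {i j} → toℕ i < toℕ j → G i j ≡ true → (i , j) ∈ edges G
  ∈-edges⁺ {i} {j} lt adj = ∈-concatMap⁺ row (lose (∈-allFin i)
    (∈-concatMap⁺ (cell i) (lose (∈-allFin j) (∈-cell⁺ i j lt adj))))

  edges-unique : Unique (edges G)
  edges-unique = concatMap-unique row
    (λ i → concatMap-unique (cell i) (cell-unique i)
      (λ a b → trans (sym (cong proj₂ (proj₁ (∈-cell⁻ i _ a)))) (cong proj₂ (proj₁ (∈-cell⁻ i _ b))))
      (UniqueP.allFin⁺ n))
    (λ a b → trans (sym (proj₁ (∈-row⁻ _ a))) (proj₁ (∈-row⁻ _ b)))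
    (UniqueP.allFin⁺ n)
    where
    cell-unique : ∀ i j → Unique (cell i j)
    cell-unique i j with (toℕ i <ᵇ toℕ j) ∧ G i j
    ... | true = [] ∷ []
    ... | false = []

  private
    subgraphs : List (Vec Bool n × List (Fin n × Fin n))
    subgraphs = concatMap (λ V → map (V ,_) (sublists (edges G))) (allSubsets n)

    subgraphs-unique : Unique subgraphs
    subgraphs-unique = concatMap-unique (λ V → map (V ,_) (sublists (edges G)))
      (λ V → UniqueP.map⁺ ProductP.,-injectiveʳ (sublists-unique edges-unique))
      (λ a b → trans (sym (first a)) (first b))
      (allSubsets-unique n)
      where
      first : ∀ {V z} → z ∈ map (V ,_) (sublists (edges G)) → proj₁ z ≡ V
      first z∈ with ∈-map⁻ _ z∈
      ... | _ , _ , refl = refl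

  ≤F : ∀ Ls → Unique Ls → (∀ {V E} → (V , E) ∈ Ls → E ∈ sublists (edges G) × isConnectedSub V E ≡ true) →
    length Ls ≤ F G
  ≤F Ls u conn = length-⊆ u λ {(V , E)} VE∈ →
    ∈-filter⁺ _ (∈-concatMap⁺ (λ V → map (V ,_) (sublists (edges G)))
      (lose (∈-allSubsets V) (∈-map⁺ (V ,_) (proj₁ (conn VE∈)))))
      (Equivalence.from T-≡ (proj₂ (conn VE∈)))

  F≤ : ∀ Ls → (∀ {V E} → E ∈ sublists (edges G) → isConnectedSub V E ≡ true → (V , E) ∈ Ls) → F G ≤ length Ls
  F≤ Ls conn = length-⊆ (UniqueP.filter⁺ _ subgraphs-unique) λ VE∈ → listed (∈-filter⁻ _ VE∈)
    where
    listed : ∀ {VE} → VE ∈ subgraphs × T (isConnectedSub (proj₁ VE) (proj₂ VE)) → VE ∈ Ls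
    listed (VE∈ , c) with find (∈-concatMap⁻ (λ V → map (V ,_) (sublists (edges G))) {xs = allSubsets n} VE∈)
    ... | V , _ , VE∈′ with ∈-map⁻ (V ,_) VE∈′
    ... | E , E∈ , refl = conn E∈ (Equivalence.to T-≡ c)

-- Reachability and connectedness

any-true⁺ : ∀ {A : Set} (f : A → Bool) {xs e} → e ∈ xs → f e ≡ true → any f xs ≡ true
any-true⁺ f (here refl) eq rewrite eq = refl
any-true⁺ f {x ∷ _} (there e∈) eq with f x
... | true = refl
... | false = any-true⁺ f e∈ eq

any-true⁻ : ∀ {A : Set} (f : A → Bool) xs → any f xs ≡ true → ∃ λ e → e ∈ xs × f e ≡ true
any-true⁻ f (x ∷ xs) eq with f x in fx
... | true = x , here refl , fx
... | false with any-true⁻ f xs eq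
... | e , e∈ , fe = e , there e∈ , fe

all-true⁺ : ∀ {A : Set} (f : A → Bool) xs → (∀ {e} → e ∈ xs → f e ≡ true) → all f xs ≡ true
all-true⁺ f [] h = refl
all-true⁺ f (x ∷ xs) h rewrite h (here refl) = all-true⁺ f xs (h ∘ there)

all-true⁻ : ∀ {A : Set} (f : A → Bool) {xs e} → all f xs ≡ true → e ∈ xs → f e ≡ true
all-true⁻ f {x ∷ xs} eq e∈ with f x in fx
all-true⁻ f {x ∷ xs} eq (here refl) | true = fx
all-true⁻ f {x ∷ xs} eq (there e∈) | true = all-true⁻ f eq e∈

∧-true⁻ : ∀ {a b} → a ∧ b ≡ true → a ≡ true × b ≡ true
∧-true⁻ {true} {true} _ = refl , refl

∧-true⁺ : ∀ {a b} → a ≡ true → b ≡ true → a ∧ b ≡ true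
∧-true⁺ refl refl = refl

∨-true⁻ : ∀ {a b} → a ∨ b ≡ true → a ≡ true ⊎ b ≡ true
∨-true⁻ {true} _ = inj₁ refl
∨-true⁻ {false} eq = inj₂ eq

∨-trueˡ : ∀ {a b} → a ≡ true → a ∨ b ≡ true
∨-trueˡ refl = refl

∨-trueʳ : ∀ {a b} → b ≡ true → a ∨ b ≡ true
∨-trueʳ {true} _ = refl
∨-trueʳ {false} eq = eq

⇔-true : ∀ {a b} → (a ≡ true → b ≡ true) → (b ≡ true → a ≡ true) → a ≡ b
⇔-true {true} f _ = sym (f refl)
⇔-true {false} {false} _ _ = refl
⇔-true {false} {true} _ g = g refl

does-true⁺ : ∀ {P : Set} (P? : Dec P) → P → ⌊ P? ⌋ ≡ true
does-true⁺ (yes _) _ = refl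
does-true⁺ (no ¬p) p = contradiction p ¬p

does-true⁻ : ∀ {P : Set} (P? : Dec P) → ⌊ P? ⌋ ≡ true → P
does-true⁻ (yes p) _ = p

==-refl : ∀ {n} (i : Fin n) → (i == i) ≡ true
==-refl i = does-true⁺ (i ≟ i) refl

==⇒≡ : ∀ {n} {i j : Fin n} → (i == j) ≡ true → i ≡ j
==⇒≡ {i = i} {j} = does-true⁻ (i ≟ j)

-- A closed property is a union of components of the edge set, so connectedness means that no such
-- property separates two vertices.
Closed : ∀ {n} → List (Fin n × Fin n) → (Fin n → Set) → Set
Closed E P = ∀ {a b} → (a , b) ∈ E → (P a → P b) × (P b → P a)

module _ {n} (E : List (Fin n × Fin n)) where

  private
    infix 4 _∋_
    _∋_ : Vec Bool n → Fin n → Set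
    R ∋ v = lookup R v ≡ true

    hit : Vec Bool n → Fin n → Fin n × Fin n → Bool
    hit R v e = (lookup R (proj₁ e) ∧ (proj₂ e == v)) ∨ (lookup R (proj₂ e) ∧ (proj₁ e == v))

    lookup-step : ∀ R v → lookup (step E R) v ≡ (lookup R v ∨ any (hit R v) E)
    lookup-step R v = lookup∘tabulate (λ v → lookup R v ∨ any (hit R v) E) v

    step-⊇ : ∀ R {v} → R ∋ v → step E R ∋ v
    step-⊇ R {v} v∈ = trans (lookup-step R v) (∨-trueˡ v∈)

    step-edge : ∀ R {a b} → (a , b) ∈ E → (R ∋ a → step E R ∋ b) × (R ∋ b → step E R ∋ a)
    step-edge R {a} {b} e∈ =
      (λ a∈ → trans (lookup-step R b) (∨-trueʳ (any-true⁺ (hit R b) e∈ (∨-trueˡ (∧-true⁺ a∈ (==-refl b)))))) ,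
      (λ b∈ → trans (lookup-step R a) (∨-trueʳ (any-true⁺ (hit R a) e∈ (∨-trueʳ {lookup R a ∧ (b == a)} (∧-true⁺ b∈ (==-refl a))))))

    step-least : ∀ {P} → Closed E P → ∀ R → (∀ {v} → R ∋ v → P v) → ∀ {v} → step E R ∋ v → P v
    step-least {P} cl R R⊆P {v} v∈ with ∨-true⁻ (trans (sym (lookup-step R v)) v∈)
    ... | inj₁ v∈R = R⊆P v∈R
    ... | inj₂ v∈R with any-true⁻ (hit R v) E v∈R
    ... | (a , b) , e∈ , h with ∨-true⁻ h
    ... | inj₁ h′ with ∧-true⁻ {lookup R a} h′
    ... | a∈ , eq = subst P (==⇒≡ eq) (proj₁ (cl e∈) (R⊆P a∈))
    step-least {P} cl R R⊆P {v} v∈ | inj₂ _ | (a , b) , e∈ , _ | inj₂ h′ with ∧-true⁻ {lookup R b} h′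
    ... | b∈ , eq = subst P (==⇒≡ eq) (proj₂ (cl e∈) (R⊆P b∈))

    step-grows : ∀ R → step E R ≡ R ⊎ ∣ R ∣ < ∣ step E R ∣
    step-grows R with any? (λ v → ¬? (lookup R v ≟ᵇ true) ×-dec (lookup (step E R) v ≟ᵇ true))
    ... | yes (v , v∉ , v∈) = inj₂ (p⊂q⇒∣p∣<∣q∣ {p = R} {step E R}
      ((λ x∈ → lookup⇒[]= _ (step E R) (step-⊇ R ([]=⇒lookup x∈))) , v , lookup⇒[]= _ (step E R) v∈ , (v∉ ∘ []=⇒lookup)))
    ... | no stable = inj₁ (trans (sym (tabulate∘lookup _)) (trans (tabulate-cong same) (tabulate∘lookup R)))
      where
      same : ∀ v → lookup (step E R) v ≡ lookup R v
      same v = ⇔-true back (step-⊇ R)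
        where
        back : step E R ∋ v → R ∋ v
        back v∈ with lookup R v in eq
        ... | true = refl
        ... | false = contradiction (v , (λ v∈R → contradiction (trans (sym eq) v∈R) λ ()) , v∈) stable

    -- Until it becomes stationary, the iteration gains a vertex in every round.
    stationary : ∀ R k → step E (iter k (step E) R) ≡ iter k (step E) R ⊎ k ≤ ∣ iter k (step E) R ∣
    stationary R zero = inj₂ z≤n
    stationary R (suc k) with stationary R k
    ... | inj₁ eq = inj₁ (cong (step E) eq)
    ... | inj₂ k≤ with step-grows (iter k (step E) R)
    ... | inj₁ eq = inj₁ (cong (step E) eq)
    ... | inj₂ lt = inj₂ (≤-<-trans k≤ lt)

  reach-self : ∀ x → lookup (reach E x) x ≡ true
  reach-self x = grow n
    where
    grow : ∀ k → iter k (step E) (tabulate (x ==_)) ∋ x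
    grow zero = trans (lookup∘tabulate (x ==_) x) (==-refl x)
    grow (suc k) = step-⊇ (iter k (step E) (tabulate (x ==_))) (grow k)

  reach-closed : ∀ x → Closed E (λ v → lookup (reach E x) v ≡ true)
  reach-closed x e∈ =
    (λ a∈ → subst (_∋ _) fixed (proj₁ (step-edge (reach E x) e∈) a∈)) ,
    (λ b∈ → subst (_∋ _) fixed (proj₂ (step-edge (reach E x) e∈) b∈))
    where
    fixed : step E (reach E x) ≡ reach E x
    fixed with stationary (tabulate (x ==_)) n
    ... | inj₁ eq = eq
    -- The set already has at least n vertices, so a further gain is impossible.
    ... | inj₂ n≤ with step-grows (reach E x)
    ... | inj₁ eq = eq
    ... | inj₂ lt = contradiction (≤-trans lt (∣p∣≤n (step E (reach E x)))) (≤⇒≯ n≤)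

  -- Together with `reach-closed` this makes the computed set the least closed one containing x,
  -- which links the Boolean test to closed properties.
  reach-least : ∀ {P} x → Closed E P → P x → ∀ {v} → lookup (reach E x) v ≡ true → P v
  reach-least {P} x cl px = least n
    where
    least : ∀ k {v} → iter k (step E) (tabulate (x ==_)) ∋ v → P v
    least zero {v} v∈ = subst P (==⇒≡ (trans (sym (lookup∘tabulate (x ==_) v)) v∈)) px
    least (suc k) v∈ = step-least cl (iter k (step E) (tabulate (x ==_))) (least k) v∈

-- The auxiliary function inside firstIn has no name; the underscores in the types below
-- stand for it and are solved by the first clause of each block.
mutual
  firstIn-just : ∀ {n} (V : Vec Bool n) {x} → firstIn V ≡ just x → lookup V x ≡ true
  firstIn-just {n} V with allFin n
  ... | is = firstIn-just-go V is

  firstIn-just-go : ∀ {n} (V : Vec Bool n) (is : List (Fin n)) {x} → _ ≡ just x → lookup V x ≡ true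
  firstIn-just-go V (i ∷ is) eq with lookup V i in eqi
  firstIn-just-go V (i ∷ is) refl | true = eqi
  ... | false = firstIn-just-go V is eq

mutual
  firstIn-nothing : ∀ {n} (V : Vec Bool n) → firstIn V ≡ nothing → All (λ i → lookup V i ≡ false) (allFin n)
  firstIn-nothing {n} V with allFin n
  ... | is = firstIn-nothing-go V is

  firstIn-nothing-go : ∀ {n} (V : Vec Bool n) (is : List (Fin n)) → _ ≡ nothing → All (λ i → lookup V i ≡ false) is
  firstIn-nothing-go V [] _ = []
  firstIn-nothing-go V (i ∷ is) eq with lookup V i in eqi
  ... | false = eqi ∷ firstIn-nothing-go V is eq

module _ {n} {V : Vec Bool n} {E : List (Fin n × Fin n)} where

  connectedSub⁺ : ∀ {x} → lookup V x ≡ true →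
    (∀ {a b} → (a , b) ∈ E → lookup V a ≡ true × lookup V b ≡ true) →
    (∀ {P} → Closed E P → ∀ {x y} → lookup V x ≡ true → lookup V y ≡ true → P x → P y) →
    isConnectedSub V E ≡ true
  connectedSub⁺ {x} x∈ ends conn with firstIn V in eq
  ... | nothing = contradiction (trans (sym x∈) (All.lookup (firstIn-nothing V eq) (∈-allFin x))) λ ()
  ... | just r = ∧-true⁺
    (all-true⁺ _ E λ e∈ → ∧-true⁺ (proj₁ (ends e∈)) (proj₂ (ends e∈)))
    (all-true⁺ (λ v → not (lookup V v) ∨ lookup (reach E r) v) (allFin n) λ {v} _ → reached v)
    where
    reached : ∀ v → not (lookup V v) ∨ lookup (reach E r) v ≡ true
    reached v with lookup V v in v∈
    ... | false = refl
    ... | true = conn (reach-closed E r) (firstIn-just V eq) v∈ (reach-self E r)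

  connectedSub⁻ : isConnectedSub V E ≡ true →
    (∃ λ x → lookup V x ≡ true) ×
    (∀ {a b} → (a , b) ∈ E → lookup V a ≡ true × lookup V b ≡ true) ×
    (∀ {P} → Closed E P → ∀ {x y} → lookup V x ≡ true → lookup V y ≡ true → P x → P y)
  connectedSub⁻ c with firstIn V in eq
  ... | just r with ∧-true⁻ {all (λ e → lookup V (proj₁ e) ∧ lookup V (proj₂ e)) E} c
  ... | ends , reached = (r , firstIn-just V eq) , (λ e∈ → ∧-true⁻ (all-true⁻ _ ends e∈)) , conn
    where
    reached′ : ∀ {v} → lookup V v ≡ true → lookup (reach E r) v ≡ true
    reached′ {v} v∈ with all-true⁻ (λ v → not (lookup V v) ∨ lookup (reach E r) v) reached (∈-allFin v)
    ... | h rewrite v∈ = h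
    conn : ∀ {P} → Closed E P → ∀ {x y} → lookup V x ≡ true → lookup V y ≡ true → P x → P y
    conn {P} cl x∈ y∈ px = proj₁ (agree y∈) (proj₂ (agree x∈) px)
      where
      agree : ∀ {v} → lookup V v ≡ true → (P r → P v) × (P v → P r)
      -- Every vertex is reached from r, but P has to be carried from x back to r as well. The
      -- property used is therefore agreement of P at r and at v.
      agree v∈ = reach-least E {λ v → (P r → P v) × (P v → P r)} r
        (λ e∈ → (λ { (f , g) → (λ pr → proj₁ (cl e∈) (f pr)) , (λ pb → g (proj₂ (cl e∈) pb)) }) ,
                (λ { (f , g) → (λ pr → proj₂ (cl e∈) (f pr)) , (λ pa → g (proj₁ (cl e∈) pa)) }))
        (id , id) (reached′ v∈)

-- Graphs whose edges are the pairs {v , p v}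

-- The last field makes v ↦ {v , p v} injective, so that sets of vertices S correspond to sets of
-- edges.
record Represents {n} (G : Graph n) (p : Fin n → Fin n) : Set where
  field
    arc-adj  : ∀ v → G v (p v) ≡ true
    adj-arc  : ∀ {i j} → G i j ≡ true → p i ≡ j ⊎ p j ≡ i
    no-2-cycle : ∀ v → p (p v) ≢ v

  no-fixpoint : ∀ v → p v ≢ v
  no-fixpoint v eq = no-2-cycle v (trans (cong p eq) eq)

-- The subgraph with vertex set V and edges {v , p v} for v ∈ S.
record ConnectedPair {n} (p : Fin n → Fin n) (V S : Fin n → Bool) : Set₁ where
  field
    nonempty : ∃ λ x → V x ≡ true
    S⊆V      : ∀ {v} → S v ≡ true → V v ≡ true
    pS⊆V     : ∀ {v} → S v ≡ true → V (p v) ≡ true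
    joined   : ∀ {P : Fin n → Set} → (∀ {v} → S v ≡ true → (P v → P (p v)) × (P (p v) → P v)) →
               ∀ {x y} → V x ≡ true → V y ≡ true → P x → P y

-- `edges` lists an edge with its smaller endpoint first, so the orientation in which an arc is
-- listed depends on v.
orient : ∀ {n} {G : Graph n} {p : Fin n → Fin n} → IsSimple G → (∀ v → G v (p v) ≡ true) → (∀ v → p v ≢ v) →
  ∀ v → ∃ λ e → e ∈ edges G × (e ≡ (v , p v) ⊎ e ≡ (p v , v))
orient {G = G} {p} simple arc-adj no-fixpoint v with toℕ v <? toℕ (p v)
... | yes lt = _ , ∈-edges⁺ G lt (arc-adj v) , inj₁ refl
... | no ≮ = _ , ∈-edges⁺ G
  (≤∧≢⇒< (≮⇒≥ ≮) (no-fixpoint v ∘ toℕ-injective)) (trans (proj₁ simple _ _) (arc-adj v)) , inj₂ refl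

module _ {n} {G : Graph n} (simple : IsSimple G) {p : Fin n → Fin n} (rep : Represents G p) where
  open Represents rep

  private
    _∈?ₑ_ : (e : Fin n × Fin n) (E : List (Fin n × Fin n)) → Dec (e ∈ E)
    _∈?ₑ_ = DecMembership._∈?_ (ProductP.≡-dec _≟_ _≟_)

    Chosen : (Fin n → Bool) → Fin n × Fin n → Set
    Chosen S (i , j) = (p i ≡ j × S i ≡ true) ⊎ (p j ≡ i × S j ≡ true)

    chosen? : ∀ S → Decidable (Chosen S)
    chosen? S (i , j) = ((p i ≟ j) ×-dec (S i ≟ᵇ true)) ⊎-dec ((p j ≟ i) ×-dec (S j ≟ᵇ true))

    encode : (Fin n → Bool) × (Fin n → Bool) → Vec Bool n × List (Fin n × Fin n)
    encode (V , S) = tabulate V , filter (chosen? S) (edges G)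

    arc-edge : ∀ v → ∃ λ e → e ∈ edges G × (e ≡ (v , p v) ⊎ e ≡ (p v , v))
    arc-edge = orient simple arc-adj no-fixpoint

    arc : Fin n → Fin n × Fin n
    arc v = proj₁ (arc-edge v)

    arc-chosen : ∀ S v → S v ≡ true → Chosen S (arc v)
    arc-chosen S v sv with arc-edge v
    ... | _ , _ , inj₁ refl = inj₁ (refl , sv)
    ... | _ , _ , inj₂ refl = inj₂ (refl , sv)

    chosen-arc : ∀ S v → Chosen S (arc v) → S v ≡ true
    chosen-arc S v c with arc-edge v | c
    ... | _ , _ , inj₁ refl | inj₁ (_ , sv) = sv
    ... | _ , _ , inj₁ refl | inj₂ (ppv , _) = contradiction ppv (no-2-cycle v)
    ... | _ , _ , inj₂ refl | inj₁ (ppv , _) = contradiction ppv (no-2-cycle v)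
    ... | _ , _ , inj₂ refl | inj₂ (_ , sv) = sv

    arc-unique : ∀ {i j} v → (i , j) ∈ edges G → (p i ≡ j × v ≡ i) ⊎ (p j ≡ i × v ≡ j) → arc v ≡ (i , j)
    arc-unique v ij∈ h with arc-edge v | h
    ... | _ , _ , inj₁ refl | inj₁ (refl , refl) = refl
    ... | _ , _ , inj₂ refl | inj₂ (refl , refl) = refl
    -- The two orientations of one edge cannot both be listed with the smaller endpoint first.
    ... | _ , vp∈ , inj₁ refl | inj₂ (refl , refl) =
      contradiction (proj₁ (∈-edges⁻ G vp∈)) (<-asym (proj₁ (∈-edges⁻ G ij∈)))
    ... | _ , pv∈ , inj₂ refl | inj₁ (refl , refl) =
      contradiction (proj₁ (∈-edges⁻ G pv∈)) (<-asym (proj₁ (∈-edges⁻ G ij∈)))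

    encode-injective : ∀ {V S V′ S′} → encode (V , S) ≡ encode (V′ , S′) → (∀ v → V v ≡ V′ v) × (∀ v → S v ≡ S′ v)
    encode-injective {V} {S} {V′} {S′} eq =
      (λ v → trans (sym (lookup∘tabulate V v)) (trans (cong (λ W → lookup W v) (cong proj₁ eq)) (lookup∘tabulate V′ v))) ,
      (λ v → ⇔-true (transfer (cong proj₂ eq) v) (transfer (sym (cong proj₂ eq)) v))
      where
      transfer : ∀ {S S′} → filter (chosen? S) (edges G) ≡ filter (chosen? S′) (edges G) →
        ∀ v → S v ≡ true → S′ v ≡ true
      transfer {S} {S′} eq v sv = chosen-arc S′ v (proj₂ (∈-filter⁻ (chosen? S′) {xs = edges G} (subst (arc v ∈_) eq
        (∈-filter⁺ (chosen? S) (proj₁ (proj₂ (arc-edge v))) (arc-chosen S v sv)))))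

    encode-cong : ∀ {V S V′ S′} → (∀ v → V v ≡ V′ v) → (∀ v → S v ≡ S′ v) → encode (V , S) ≡ encode (V′ , S′)
    encode-cong {V} {S} {V′} {S′} V≗ S≗ = cong₂ _,_ (tabulate-cong V≗) (filter-≐ (chosen? S) (chosen? S′)
      ((λ { (inj₁ (a , b)) → inj₁ (a , trans (sym (S≗ _)) b) ; (inj₂ (a , b)) → inj₂ (a , trans (sym (S≗ _)) b) }) ,
       (λ { (inj₁ (a , b)) → inj₁ (a , trans (S≗ _) b) ; (inj₂ (a , b)) → inj₂ (a , trans (S≗ _) b) }))
      (edges G))

    encode-connected : ∀ {V S} → ConnectedPair p V S → isConnectedSub (proj₁ (encode (V , S))) (proj₂ (encode (V , S))) ≡ true
    encode-connected {V} {S} c = connectedSub⁺ (to (proj₂ nonempty)) ends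
      (λ {P} cl {x} {y} x∈ y∈ → joined {P} (arcs-closed cl) (from x∈) (from y∈))
      where
      open ConnectedPair c
      to : ∀ {v} → V v ≡ true → lookup (tabulate V) v ≡ true
      to {v} = trans (lookup∘tabulate V v)
      from : ∀ {v} → lookup (tabulate V) v ≡ true → V v ≡ true
      from {v} = trans (sym (lookup∘tabulate V v))
      ends : ∀ {a b} → (a , b) ∈ filter (chosen? S) (edges G) → lookup (tabulate V) a ≡ true × lookup (tabulate V) b ≡ true
      ends e∈ with proj₂ (∈-filter⁻ (chosen? S) {xs = edges G} e∈)
      ... | inj₁ (refl , sa) = to (S⊆V sa) , to (pS⊆V sa)
      ... | inj₂ (refl , sb) = to (pS⊆V sb) , to (S⊆V sb)
      arcs-closed : ∀ {P} → Closed (filter (chosen? S) (edges G)) P → ∀ {v} → S v ≡ true → (P v → P (p v)) × (P (p v) → P v)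
      arcs-closed cl {v} sv with arc-edge v | arc-chosen S v sv
      ... | _ , e∈ , inj₁ refl | ch = cl (∈-filter⁺ (chosen? S) e∈ ch)
      ... | _ , e∈ , inj₂ refl | ch = proj₂ (cl (∈-filter⁺ (chosen? S) e∈ ch)) , proj₁ (cl (∈-filter⁺ (chosen? S) e∈ ch))

    -- S collects the vertices whose arc lies in E. That S gives back all of E rests on `adj-arc`:
    -- every edge is an arc.
    decode : ∀ {V E} → E ∈ sublists (edges G) → isConnectedSub V E ≡ true →
      ∃ λ S → ConnectedPair p (lookup V) S × (V , E) ≡ encode (lookup V , S)
    decode {V} {E} E∈ conn with connectedSub⁻ {V = V} {E} conn
    ... | nonempty , ends , joined = S , record
      { nonempty = nonempty
      ; S⊆V = λ sv → proj₁ (arc-ends sv)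
      ; pS⊆V = λ sv → proj₂ (arc-ends sv)
      ; joined = λ {P} cl → joined {P} λ e∈ → edge-closed cl e∈
      } , cong₂ _,_ (sym (tabulate∘lookup V)) (sublist≡filter (chosen? S) (edges-unique G) E∈ E⊆ ⊆E)
      where
      S : Fin n → Bool
      S v = ⌊ arc v ∈?ₑ E ⌋
      in-E : ∀ {v} → S v ≡ true → arc v ∈ E
      in-E {v} = does-true⁻ (arc v ∈?ₑ E)
      arc-ends : ∀ {v} → S v ≡ true → lookup V v ≡ true × lookup V (p v) ≡ true
      arc-ends {v} sv with arc-edge v | in-E {v} sv
      ... | _ , _ , inj₁ refl | e∈ = ends e∈
      ... | _ , _ , inj₂ refl | e∈ = proj₂ (ends e∈) , proj₁ (ends e∈)
      in-S : ∀ {i j} v → (i , j) ∈ E → (p i ≡ j × v ≡ i) ⊎ (p j ≡ i × v ≡ j) → S v ≡ true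
      in-S v e∈ h = does-true⁺ (arc v ∈?ₑ E) (subst (_∈ E) (sym (arc-unique v (sublists-⊆ (edges G) E∈ e∈) h)) e∈)
      E⊆ : ∀ {e} → e ∈ E → Chosen S e
      E⊆ {i , j} e∈ with adj-arc (proj₂ (∈-edges⁻ G (sublists-⊆ (edges G) E∈ e∈)))
      ... | inj₁ eq = inj₁ (eq , in-S i e∈ (inj₁ (eq , refl)))
      ... | inj₂ eq = inj₂ (eq , in-S j e∈ (inj₂ (eq , refl)))
      ⊆E : ∀ {e} → e ∈ edges G → Chosen S e → e ∈ E
      ⊆E {i , j} e∈ (inj₁ (eq , si)) = subst (_∈ E) (arc-unique i e∈ (inj₁ (eq , refl))) (in-E si)
      ⊆E {i , j} e∈ (inj₂ (eq , sj)) = subst (_∈ E) (arc-unique j e∈ (inj₂ (eq , refl))) (in-E sj)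
      edge-closed : ∀ {P} → (∀ {v} → S v ≡ true → (P v → P (p v)) × (P (p v) → P v)) → Closed E P
      edge-closed cl e∈ with E⊆ e∈
      ... | inj₁ (refl , si) = cl si
      ... | inj₂ (refl , sj) = proj₂ (cl sj) , proj₁ (cl sj)

  -- V and S are functions here, so distinctness of two pairs is required in the pointwise form.
  ≤F-pairs : ∀ cs → (∀ {c} → c ∈ cs → ConnectedPair p (proj₁ c) (proj₂ c)) →
    AllPairs (λ c c′ → ¬ ((∀ v → proj₁ c v ≡ proj₁ c′ v) × (∀ v → proj₂ c v ≡ proj₂ c′ v))) cs → length cs ≤ F G
  ≤F-pairs cs conn apart = subst (_≤ F G) (length-map encode cs) (≤F G (map encode cs)
    (AllPairsP.map⁺ (AllPairs.map (_∘ encode-injective) apart)) connected)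
    where
    connected : ∀ {V E} → (V , E) ∈ map encode cs → E ∈ sublists (edges G) × isConnectedSub V E ≡ true
    connected VE∈ with ∈-map⁻ encode VE∈
    ... | (V , S) , c∈ , refl = filter-∈-sublists (chosen? S) (edges G) , encode-connected (conn c∈)

  F≤-pairs : ∀ cs → (∀ {V S} → ConnectedPair p V S →
      ∃ λ c → c ∈ cs × (∀ v → V v ≡ proj₁ c v) × (∀ v → S v ≡ proj₂ c v)) → F G ≤ length cs
  F≤-pairs cs listed = subst (F G ≤_) (length-map encode cs) (F≤ G (map encode cs) found)
    where
    found : ∀ {V E} → E ∈ sublists (edges G) → isConnectedSub V E ≡ true → (V , E) ∈ map encode cs
    found {V} {E} E∈ conn with decode {V} E∈ conn
    ... | S , c , eq with listed c
    ... | c′ , c∈ , V≗ , S≗ = subst (_∈ map encode cs) (sym (trans eq (encode-cong V≗ S≗))) (∈-map⁺ encode c∈)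

-- Functions whose iterates all run into one cycle

_∈?_ : ∀ {n} (v : Fin n) (vs : List (Fin n)) → Dec (v ∈ vs)
_∈?_ = DecMembership._∈?_ _≟_

least : ∀ {P : ℕ → Set} → Decidable P → ∀ k → P k → ∃ λ m → P m × (∀ {j} → j < m → ¬ P j)
least P? zero p0 = 0 , p0 , λ ()
least {P} P? (suc k) pk with P? 0
... | yes p0 = 0 , p0 , λ ()
... | no ¬p0 with least {P ∘ suc} (λ j → P? (suc j)) k pk
... | m , pm , below = suc m , pm , λ { {zero} _ → ¬p0 ; {suc j} (s≤s j<m) → below j<m }

-- The functional graph of p has the shape of the letter ρ, with possibly many tails: one cycle, of
-- exact length g, into which everything runs. The base point `o` is any vertex of the cycle.
record Rho {n} (g : ℕ) (p : Fin n → Fin n) : Set where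
  field
    o       : Fin n
    3≤g     : 3 ≤ g
    period  : iter g p o ≡ o
    minimal : ∀ {k} → 0 < k → k < g → iter k p o ≢ o
    reaches : ∀ v → ∃ λ k → iter k p v ≡ o

module _ {n} (p : Fin n → Fin n) where

  iter-+ : ∀ a b x → iter (a + b) p x ≡ iter a p (iter b p x)
  iter-+ zero b x = refl
  iter-+ (suc a) b x = cong p (iter-+ a b x)

  iter-comm : ∀ a b x → iter a p (iter b p x) ≡ iter b p (iter a p x)
  iter-comm a b x = trans (sym (iter-+ a b x)) (trans (cong (λ k → iter k p x) (+-comm a b)) (iter-+ b a x))

  iter-∸ : ∀ {a b} x → b ≤ a → iter a p x ≡ iter (a ∸ b) p (iter b p x)
  iter-∸ {a} {b} x b≤a = trans (cong (λ k → iter k p x) (sym (m∸n+n≡m b≤a))) (iter-+ (a ∸ b) b x)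

  infix 4 _⊑_
  _⊑_ : Fin n → Fin n → Set
  u ⊑ v = ∃ λ k → iter k p u ≡ v

  ⊑-refl : ∀ {u} → u ⊑ u
  ⊑-refl = 0 , refl

  ⊑-trans : ∀ {u v w} → u ⊑ v → v ⊑ w → u ⊑ w
  ⊑-trans {u} (k , refl) (l , eq) = l + k , trans (iter-+ l k u) eq

  ⊑-step : ∀ u → u ⊑ p u
  ⊑-step u = 1 , refl

  -- Two iterates of u are compared by their numbers of steps. Consequently incomparable vertices
  -- have no common lower bound.
  ⊑-total : ∀ {u v w} → u ⊑ v → u ⊑ w → v ⊑ w ⊎ w ⊑ v
  ⊑-total {u} (k , refl) (l , refl) with ≤-total k l
  ... | inj₁ k≤l = inj₁ (l ∸ k , sym (iter-∸ u k≤l))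
  ... | inj₂ l≤k = inj₂ (k ∸ l , sym (iter-∸ u l≤k))

module Orbits {n g} {p : Fin n → Fin n} (ρ : Rho g p) where
  open Rho ρ public

  infix 4 _≼_
  -- The order points towards the cycle: tips of tails are minimal, and a cyclic vertex is above
  -- every vertex.
  _≼_ : Fin n → Fin n → Set
  _≼_ = _⊑_ p

  0<g : 0 < g
  0<g = ≤-trans (s≤s z≤n) 3≤g

  Cyclic : Fin n → Set
  Cyclic v = o ≼ v

  cyclic-p : ∀ {v} → Cyclic v → Cyclic (p v)
  cyclic-p c = ⊑-trans p c (⊑-step p _)

  ≼-cyclic : ∀ {u v} → Cyclic v → u ≼ v
  ≼-cyclic {u} c = ⊑-trans p (reaches u) c

  cyclic-period : ∀ {v} → Cyclic v → iter g p v ≡ v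
  cyclic-period (k , refl) = trans (iter-comm p g k o) (cong (iter k p) period)

  cyclic-index : ∀ {v} → Cyclic v → ∃ λ i → i < g × iter i p o ≡ v
  cyclic-index (k , refl) = <-rec (λ k → ∃ λ i → i < g × iter i p o ≡ iter k p o) reduce k
    where
    reduce : ∀ k → (∀ {j} → j < k → ∃ λ i → i < g × iter i p o ≡ iter j p o) → ∃ λ i → i < g × iter i p o ≡ iter k p o
    reduce k rec with k <? g
    ... | yes k<g = k , k<g , refl
    ... | no k≮g with rec {k ∸ g} (∸-monoʳ-< 0<g (≮⇒≥ k≮g))
    ... | i , i<g , eq = i , i<g , trans eq (trans (cong (iter (k ∸ g) p) (sym period)) (sym (iter-∸ p o (≮⇒≥ k≮g))))

  cycle : List (Fin n)
  cycle = applyUpTo (λ k → iter k p o) g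

  cyclic? : Decidable Cyclic
  cyclic? v = map′ (λ v∈ → proj₁ (∈-applyUpTo⁻ _ v∈) , sym (proj₂ (proj₂ (∈-applyUpTo⁻ _ v∈))))
    (λ c → subst (_∈ cycle) (proj₂ (proj₂ (cyclic-index c))) (∈-applyUpTo⁺ _ (proj₁ (proj₂ (cyclic-index c)))))
    (v ∈? cycle)

  cyclic-minimal : ∀ {v k} → Cyclic v → 0 < k → k < g → iter k p v ≢ v
  cyclic-minimal {v} {k} c 0<k k<g eq with reaches v
  ... | b , refl = minimal 0<k k<g (trans (iter-comm p k b v) (cong (iter b p) eq))

  cyclic-distinct : ∀ {v i j} → Cyclic v → i < j → j < g → iter i p v ≢ iter j p v
  cyclic-distinct {v} {i} {j} c i<j j<g eq =
    cyclic-minimal (⊑-trans p c (i , refl)) (m<n⇒0<n∸m i<j) (≤-<-trans (m∸n≤m j i) j<g)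
      (trans (sym (iter-∸ p v (<⇒≤ i<j))) (sym eq))

  cyclic-injective : ∀ {v i j} → Cyclic v → i < g → j < g → iter i p v ≡ iter j p v → i ≡ j
  cyclic-injective {v} {i} {j} c i<g j<g eq with <-cmp i j
  ... | tri< i<j _ _ = contradiction eq (cyclic-distinct c i<j j<g)
  ... | tri≈ _ i≡j _ = i≡j
  ... | tri> _ _ j<i = contradiction (sym eq) (cyclic-distinct c j<i i<g)

  -- If v meets `o` after a steps, then k · a further steps make (k + 1) · a in all. This is a
  -- multiple of the return time, so v is an iterate of `o`.
  recurrent⇒cyclic : ∀ {v} k → iter (suc k) p v ≡ v → Cyclic v
  recurrent⇒cyclic {v} k eq with reaches v
  ... | a , refl = k * a , trans (sym (iter-+ p (k * a) a v))
    (trans (cong (λ m → iter m p v) (trans (+-comm (k * a) a) (*-comm (suc k) a))) (loop a))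
    where
    loop : ∀ m → iter (m * suc k) p v ≡ v
    loop zero = refl
    loop (suc m) = trans (iter-+ p (suc k) (m * suc k) v) (trans (cong (iter (suc k) p) (loop m)) eq)

  ≼-antisym : ∀ {u v} → u ≼ v → v ≼ u → u ≡ v ⊎ Cyclic u
  ≼-antisym (zero , eq) _ = inj₁ eq
  ≼-antisym {u} (suc k , refl) (l , eq) = inj₂ (recurrent⇒cyclic (l + k)
    (trans (cong (λ m → iter m p u) (sym (+-suc l k))) (trans (iter-+ p l (suc k) u) eq)))

  -- Such a v would lie on the cycle, whose length is at least 3.
  no-2-cycle : ∀ v → p (p v) ≢ v
  no-2-cycle v eq = cyclic-minimal (recurrent⇒cyclic 1 eq) (s≤s z≤n) 3≤g eq

  private
    entry : ∀ u → ∃ λ k → Cyclic (iter k p u) × (∀ {j} → j < k → ¬ Cyclic (iter j p u))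
    entry u = least (λ k → cyclic? (iter k p u)) (proj₁ (reaches u)) (subst Cyclic (sym (proj₂ (reaches u))) (⊑-refl p))

  depth : Fin n → ℕ
  depth u = proj₁ (entry u)

  depth-cyclic : ∀ u → Cyclic (iter (depth u) p u)
  depth-cyclic u = proj₁ (proj₂ (entry u))

  depth-minimal : ∀ u {j} → j < depth u → ¬ Cyclic (iter j p u)
  depth-minimal u = proj₂ (proj₂ (entry u))

  beyond-depth : ∀ u k → iter (depth u + k) p u ≡ iter k p (iter (depth u) p u)
  beyond-depth u k = trans (cong (λ m → iter m p u) (+-comm (depth u) k)) (iter-+ p k (depth u) u)

  -- After `depth u` steps the sequence is periodic with period g, so this many terms exhaust the
  -- forward orbit. The finite list makes `≼` decidable.
  orbit : Fin n → List (Fin n)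
  orbit u = applyUpTo (λ k → iter k p u) (depth u + g)

  ∈-orbit⁻ : ∀ {u v} → v ∈ orbit u → u ≼ v
  ∈-orbit⁻ v∈ with ∈-applyUpTo⁻ _ v∈
  ... | k , _ , refl = k , refl

  orbit-closed : ∀ {u v} → v ∈ orbit u → p v ∈ orbit u
  orbit-closed {u} v∈ with ∈-applyUpTo⁻ _ v∈
  ... | k , k< , refl with suc k <? depth u + g
  ... | yes sk< = ∈-applyUpTo⁺ (λ k → iter k p u) sk<
  -- The last listed term is followed by the entry point of u, listed at index `depth u`.
  ... | no sk≮ = subst (_∈ orbit u)
    (trans (sym (cyclic-period (depth-cyclic u))) (trans (sym (beyond-depth u g))
      (cong (λ m → iter m p u) (≤-antisym (≮⇒≥ sk≮) k<))))
    (∈-applyUpTo⁺ (λ k → iter k p u) (m<m+n (depth u) 0<g))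

  ∈-orbit⁺ : ∀ {u v} → u ≼ v → v ∈ orbit u
  ∈-orbit⁺ {u} (zero , refl) = ∈-applyUpTo⁺ (λ k → iter k p u) (≤-trans 0<g (m≤n+m g (depth u)))
  ∈-orbit⁺ {u} (suc k , refl) = orbit-closed {u} (∈-orbit⁺ (k , refl))

  infix 4 _≼?_
  _≼?_ : ∀ u v → Dec (u ≼ v)
  u ≼? v = map′ ∈-orbit⁻ ∈-orbit⁺ (v ∈? orbit u)

  off : List (Fin n)
  off = filter (λ v → ¬? (cyclic? v)) (allFin n)

  ∈-off⁻ : ∀ {v} → v ∈ off → ¬ Cyclic v
  ∈-off⁻ v∈ = proj₂ (∈-filter⁻ (λ v → ¬? (cyclic? v)) {xs = allFin n} v∈)

  ∈-off⁺ : ∀ {v} → ¬ Cyclic v → v ∈ off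
  ∈-off⁺ {v} ¬c = ∈-filter⁺ (λ v → ¬? (cyclic? v)) (∈-allFin v) ¬c

  off-unique : Unique off
  off-unique = UniqueP.filter⁺ _ (UniqueP.allFin⁺ n)

  length-off : g + length off ≡ n
  length-off = begin
    g + length off                ≡⟨ cong (_+ length off) (length-applyUpTo (λ k → iter k p o) g) ⟨
    length cycle + length off     ≡⟨ length-++ cycle ⟨
    length (cycle ++ off)         ≡⟨ ≤-antisym (length-⊆ whole-unique (λ {v} _ → ∈-allFin v)) (length-⊆ (UniqueP.allFin⁺ n) (λ {v} _ → covered v)) ⟩
    length (allFin n)             ≡⟨ length-tabulate id ⟩
    n                             ∎
    where
    open ≡-Reasoning
    cycle⁻ : ∀ {v} → v ∈ cycle → Cyclic v
    cycle⁻ v∈ with ∈-applyUpTo⁻ _ v∈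
    ... | k , _ , refl = k , refl
    covered : ∀ v → v ∈ cycle ++ off
    covered v with cyclic? v
    ... | no ¬c = ∈-++⁺ʳ cycle (∈-off⁺ ¬c)
    ... | yes c with cyclic-index c
    ... | i , i<g , refl = ∈-++⁺ˡ (∈-applyUpTo⁺ (λ k → iter k p o) i<g)
    whole-unique : Unique (cycle ++ off)
    whole-unique = UniqueP.++⁺
      (UniqueP.applyUpTo⁺₁ _ g (cyclic-distinct (⊑-refl p)))
      off-unique (λ { (c , f) → ∈-off⁻ f (cycle⁻ c) })

  rotate : ∀ {o′} → Cyclic o′ → Rho g p
  rotate {o′} c = record
    { o = o′ ; 3≤g = 3≤g ; period = cyclic-period c ; minimal = cyclic-minimal c ; reaches = λ v → ≼-cyclic c }

-- The lower bound

length-cartesianProduct : ∀ {A B : Set} (xs : List A) (ys : List B) →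
  length (cartesianProduct xs ys) ≡ length xs * length ys
length-cartesianProduct [] ys = refl
length-cartesianProduct (x ∷ xs) ys = trans (length-++ (map (x ,_) ys))
  (cong₂ _+_ (length-map (x ,_) ys) (length-cartesianProduct xs ys))

allPairs-∈ : ∀ {A : Set} {Q R : A → A → Set} {xs} → AllPairs Q xs →
  (∀ {x y} → x ∈ xs → y ∈ xs → Q x y → R x y) → AllPairs R xs
allPairs-∈ [] _ = []
allPairs-∈ (qx ∷ q) h =
  All.tabulate (λ y∈ → h (here refl) (there y∈) (All.lookup qx y∈)) ∷ allPairs-∈ q (λ x∈ y∈ → h (there x∈) (there y∈))

pairs-unique : ∀ {A : Set} {xs : List A} → Unique xs → Unique (pairs xs)
pairs-unique u = AllPairs.map (λ ≄ eq → ≄ (inj₁ (cong proj₁ eq , cong proj₂ eq))) (pairs-distinct u)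

module LowerBound {n g} {G : Graph n} (simple : IsSimple G) {p : Fin n → Fin n}
                  (rep : Represents G p) (ρ : Rho g p) where
  open Orbits ρ

  -- A vertex list together with the only listed vertex, if any, whose arc is left out.
  Sub : Set
  Sub = List (Fin n) × Maybe (Fin n)

  private
    _≟ᵐ_ : (s t : Maybe (Fin n)) → Dec (s ≡ t)
    _≟ᵐ_ = MaybeP.≡-dec _≟_

    starts? : ∀ ((vs , s) : Sub) v → Dec (v ∈ vs × s ≢ just v)
    starts? (vs , s) v = (v ∈? vs) ×-dec ¬? (s ≟ᵐ just v)

    Vₛ Sₛ : Sub → Fin n → Bool
    Vₛ (vs , _) v = ⌊ v ∈? vs ⌋
    Sₛ c v = ⌊ starts? c v ⌋

  -- A certificate of connectedness: every listed vertex runs along p into the hub without leaving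
  -- the list. The hub is the sink if there is one; the sinkless codes take `o`.
  record Valid (c : Sub) : Set where
    field
      hub    : Fin n
      hub∈   : hub ∈ proj₁ c
      to-hub : ∀ {v} → v ∈ proj₁ c → v ≼ hub
      closed : ∀ {v} → v ∈ proj₁ c → proj₂ c ≢ just v → p v ∈ proj₁ c
      sink   : ∀ {r} → proj₂ c ≡ just r → r ≡ hub

  -- The vertex lists are compared as sets, because V remembers neither their order nor repetitions.
  Same : Sub → Sub → Set
  Same c c′ = proj₂ c ≡ proj₂ c′ × (∀ {v} → v ∈ proj₁ c → v ∈ proj₁ c′) × (∀ {v} → v ∈ proj₁ c′ → v ∈ proj₁ c)

  private
    valid-connected : ∀ {c} → Valid c → ConnectedPair p (Vₛ c) (Sₛ c)
    valid-connected {c@(vs , s)} val = record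
      { nonempty = hub , does-true⁺ (hub ∈? vs) hub∈
      ; S⊆V = λ {v} sv → does-true⁺ (v ∈? vs) (proj₁ (does-true⁻ (starts? c v) sv))
      ; pS⊆V = λ {v} sv → does-true⁺ (p v ∈? vs)
          (closed (proj₁ (does-true⁻ (starts? c v) sv)) (proj₂ (does-true⁻ (starts? c v) sv)))
      ; joined = λ {P} cl {x} {y} x∈ y∈ →
          proj₂ (to-hub-iff {P} cl (does-true⁻ (y ∈? vs) y∈)) ∘ proj₁ (to-hub-iff {P} cl (does-true⁻ (x ∈? vs) x∈))
      }
      where
      open Valid val
      along : ∀ {P : Fin n → Set} → (∀ {v} → Sₛ c v ≡ true → (P v → P (p v)) × (P (p v) → P v)) →
        ∀ {v} k → v ∈ vs → iter k p v ≡ hub → (P v → P hub) × (P hub → P v)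
      along cl zero v∈ refl = id , id
      along {P} cl {v} (suc k) v∈ eq with s ≟ᵐ just v
      -- The walk can be interrupted only at the sink, and the sink is the hub.
      ... | yes s≡v with sink s≡v
      ... | refl = id , id
      along {P} cl {v} (suc k) v∈ eq | no s≢v =
        proj₁ rest ∘ proj₁ here-v , proj₂ here-v ∘ proj₂ rest
        where
        here-v = cl (does-true⁺ (starts? c v) (v∈ , s≢v))
        rest = along {P} cl k (closed v∈ s≢v) (trans (sym (iter-comm p 1 k v)) eq)
      to-hub-iff : ∀ {P : Fin n → Set} → (∀ {v} → Sₛ c v ≡ true → (P v → P (p v)) × (P (p v) → P v)) →
        ∀ {v} → v ∈ vs → (P v → P hub) × (P hub → P v)
      to-hub-iff {P} cl v∈ = along {P} cl (proj₁ (to-hub v∈)) v∈ (proj₂ (to-hub v∈))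

    -- The sink is visible in the pair of V and S: as the hub it is listed, so it is in V, and it is
    -- missing from S.
    sinks-agree : ∀ {c c′} → Valid c → Valid c′ → (∀ v → Vₛ c v ≡ Vₛ c′ v) → (∀ v → Sₛ c v ≡ Sₛ c′ v) →
      ∀ {r} → proj₂ c ≡ just r → proj₂ c′ ≡ just r
    sinks-agree {c@(vs , s)} {c′@(ws , t)} val val′ V≗ S≗ {r} eq with t ≟ᵐ just r
    ... | yes t≡r = t≡r
    ... | no t≢r = contradiction eq (proj₂ (does-true⁻ (starts? c r) (trans (S≗ r) (does-true⁺ (starts? c′ r) (r∈ws , t≢r)))))
      where
      r∈vs : r ∈ vs
      r∈vs = subst (_∈ vs) (sym (Valid.sink val eq)) (Valid.hub∈ val)
      r∈ws : r ∈ ws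
      r∈ws = does-true⁻ (r ∈? ws) (trans (sym (V≗ r)) (does-true⁺ (r ∈? vs) r∈vs))

    agree⇒same : ∀ {c c′} → Valid c → Valid c′ → (∀ v → Vₛ c v ≡ Vₛ c′ v) × (∀ v → Sₛ c v ≡ Sₛ c′ v) → Same c c′
    agree⇒same {c@(vs , s)} {c′@(ws , t)} val val′ (V≗ , S≗) =
      sinks s t refl refl ,
      (λ {v} v∈ → does-true⁻ (v ∈? ws) (trans (sym (V≗ v)) (does-true⁺ (v ∈? vs) v∈))) ,
      (λ {v} v∈ → does-true⁻ (v ∈? vs) (trans (V≗ v) (does-true⁺ (v ∈? ws) v∈)))
      where
      sinks : ∀ s′ t′ → s ≡ s′ → t ≡ t′ → s ≡ t
      sinks (just r) _ eq _ = trans eq (sym (sinks-agree val val′ V≗ S≗ eq))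
      sinks nothing (just r) _ eq = trans (sinks-agree val′ val (sym ∘ V≗) (sym ∘ S≗) eq) (sym eq)
      sinks nothing nothing eq eq′ = trans eq (sym eq′)

  ≤F-valid : ∀ cs → (∀ {c} → c ∈ cs → Valid c) → AllPairs (λ c c′ → ¬ Same c c′) cs → length cs ≤ F G
  ≤F-valid cs val apart = subst (_≤ F G) (length-map pair cs) (≤F-pairs simple rep (map pair cs) conn
    (AllPairsP.map⁺ (allPairs-∈ apart λ c∈ c′∈ ¬same → ¬same ∘ agree⇒same (val c∈) (val c′∈))))
    where
    pair : Sub → (Fin n → Bool) × (Fin n → Bool)
    pair c = Vₛ c , Sₛ c
    conn : ∀ {q} → q ∈ map pair cs → ConnectedPair p (proj₁ q) (proj₂ q)
    conn q∈ with ∈-map⁻ pair q∈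
    ... | c , c∈ , refl = valid-connected (val c∈)

  -- `o` stands for a tail of length zero, which puts the subgraphs of the cycle through `o` into
  -- the same families as those hanging on a tail.
  tops : List (Fin n)
  tops = o ∷ off

  tops-unique : Unique tops
  tops-unique = All.tabulate (λ { u∈ refl → ∈-off⁻ u∈ (⊑-refl p) }) ∷ off-unique

  cyclic-top : ∀ {u} → u ∈ tops → Cyclic u → u ≡ o
  cyclic-top (here eq) _ = eq
  cyclic-top (there u∈) c = contradiction c (∈-off⁻ u∈)

  -- Antisymmetry of `≼` fails only between different cyclic vertices, and `o` is the only cyclic
  -- top.
  tops-antisym : ∀ {u v} → u ∈ tops → v ∈ tops → u ≼ v → v ≼ u → u ≡ v
  tops-antisym u∈ v∈ u≼v v≼u with ≼-antisym u≼v v≼u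
  ... | inj₁ eq = eq
  ... | inj₂ c = trans (cyclic-top u∈ c) (sym (cyclic-top v∈ (⊑-trans p c u≼v)))

  -- The tail of u, entering the cycle at position 0, together with the cycle positions
  -- 0 … j and t + 1 … g − 1.
  broken : Fin n → ℕ → ℕ → Sub
  broken u j t = applyUpTo (λ k → iter k p u) (suc (depth u + j)) ++ applyUpTo (λ k → iter (depth u + suc t + k) p u) (g ∸ suc t)
               , just (iter (depth u + j) p u)

  -- The cycle positions i + 1 … j + 1 counted from o.
  segment : ℕ → ℕ → Sub
  segment i j = applyUpTo (λ k → iter (suc i + k) p o) (suc (j ∸ i)) , just (iter (suc j) p o)

  whole : Fin n → Sub
  whole u = orbit u , nothing

  path : Fin n → ℕ → List (Fin n)
  path u k = applyUpTo (λ i → iter i p u) (suc k)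

  join : Fin n → Fin n → Sub
  join u v with u ≼? v | v ≼? u
  ... | yes (k , _) | _ = path u k , just v
  ... | no _ | yes (k , _) = path v k , just u
  ... | no _ | no _ = orbit u ++ orbit v , nothing

  -- The graph of `join`, with its two comparable cases merged by `≋` so that later arguments treat
  -- them once.
  data Join (u v : Fin n) : Sub → Set where
    chain : ∀ {a b} → (a , b) ≋ (u , v) → ((k , _) : a ≼ b) → Join u v (path a k , just b)
    fork  : ¬ u ≼ v → ¬ v ≼ u → Join u v (orbit u ++ orbit v , nothing)

  join-view : ∀ u v → Join u v (join u v)
  join-view u v with u ≼? v | v ≼? u
  ... | yes u≼v | _ = chain (inj₁ (refl , refl)) u≼v
  ... | no _ | yes v≼u = chain (inj₂ (refl , refl)) v≼u
  ... | no u⋠v | no v⋠u = fork u⋠v v⋠u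

  -- Validity of the codes, and recovery of their parameters.

  ∈-broken⁻ : ∀ {u j t v} → t < g → v ∈ proj₁ (broken u j t) →
    ∃ λ k → v ≡ iter k p u × (k ≤ depth u + j ⊎ (depth u + suc t ≤ k × k < depth u + g))
  ∈-broken⁻ {u} {j} {t} t<g v∈ with ∈-++⁻ (applyUpTo (λ k → iter k p u) (suc (depth u + j))) v∈
  ... | inj₁ v∈′ with ∈-applyUpTo⁻ (λ k → iter k p u) v∈′
  ... | k , s≤s k≤ , refl = k , refl , inj₁ k≤
  ∈-broken⁻ {u} {j} {t} t<g v∈ | inj₂ v∈′ with ∈-applyUpTo⁻ (λ k → iter (depth u + suc t + k) p u) v∈′
  ... | k , k< , refl = depth u + suc t + k , refl , inj₂ (m≤m+n _ k , (begin-strict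
    depth u + suc t + k          ≡⟨ +-assoc (depth u) (suc t) k ⟩
    depth u + (suc t + k)        <⟨ +-monoʳ-< (depth u) (+-monoʳ-< (suc t) k<) ⟩
    depth u + (suc t + (g ∸ suc t)) ≡⟨ cong (depth u +_) (m+[n∸m]≡n t<g) ⟩
    depth u + g                  ∎))
    where open ≤-Reasoning

  ∈-broken⁺ : ∀ {u j t} k → k ≤ depth u + j ⊎ (depth u + suc t ≤ k × k < depth u + g) → iter k p u ∈ proj₁ (broken u j t)
  ∈-broken⁺ {u} k (inj₁ k≤) = ∈-++⁺ˡ (∈-applyUpTo⁺ (λ k → iter k p u) (s≤s k≤))
  ∈-broken⁺ {u} {j} {t} k (inj₂ (≤k , k<)) = ∈-++⁺ʳ (applyUpTo (λ k → iter k p u) (suc (depth u + j)))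
    (subst (_∈ applyUpTo (λ k → iter (depth u + suc t + k) p u) (g ∸ suc t))
      (cong (λ m → iter m p u) (m+[n∸m]≡n ≤k))
      (∈-applyUpTo⁺ (λ k → iter (depth u + suc t + k) p u) bound))
    where
    bound : k ∸ (depth u + suc t) < g ∸ suc t
    bound = subst (k ∸ (depth u + suc t) <_) ([m+n]∸[m+o]≡n∸o (depth u) g (suc t)) (∸-monoˡ-< k< ≤k)

  broken-valid : ∀ {u j t} → t < g → Valid (broken u j t)
  broken-valid {u} {j} {t} t<g = record
    { hub = iter (depth u + j) p u
    ; hub∈ = ∈-broken⁺ {u} {j} {t} (depth u + j) (inj₁ ≤-refl)
    ; to-hub = λ _ → ≼-cyclic (subst Cyclic (sym (beyond-depth u j)) (⊑-trans p (depth-cyclic u) (j , refl)))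
    ; closed = next
    ; sink = λ { refl → refl }
    }
    where
    next : ∀ {v} → v ∈ proj₁ (broken u j t) → just (iter (depth u + j) p u) ≢ just v → p v ∈ proj₁ (broken u j t)
    next v∈ ≢sink with ∈-broken⁻ {u} {j} {t} t<g v∈
    ... | k , refl , inj₁ k≤ = ∈-broken⁺ {u} {j} {t} (suc k) (inj₁ (≤∧≢⇒< k≤ λ { refl → ≢sink refl }))
    ... | k , refl , inj₂ (≤k , k<) with suc k <? depth u + g
    ... | yes sk< = ∈-broken⁺ {u} {j} {t} (suc k) (inj₂ (m≤n⇒m≤1+n ≤k , sk<))
    -- The arc out of cycle position g - 1 leads to position 0, the entry point, which every such
    -- code contains.
    ... | no sk≮ = subst (_∈ proj₁ (broken u j t))
      (trans (sym (cyclic-period (depth-cyclic u))) (trans (sym (beyond-depth u g)) (cong (λ m → iter m p u) (≤-antisym (≮⇒≥ sk≮) k<))))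
      (∈-broken⁺ {u} {j} {t} (depth u) (inj₁ (m≤m+n (depth u) j)))

  broken-top : ∀ u j t → u ∈ proj₁ (broken u j t)
  broken-top u j t = ∈-broken⁺ {u} {j} {t} 0 (inj₁ z≤n)

  broken-below : ∀ {u j t v} → t < g → v ∈ proj₁ (broken u j t) → u ≼ v
  broken-below {u} {j} {t} t<g v∈ with ∈-broken⁻ {u} {j} {t} t<g v∈
  ... | k , refl , _ = k , refl

  -- A vertex listed before the entry point is not cyclic. From there on a vertex determines its
  -- position below g, and position s + 1 lies strictly between the two listed ranges.
  broken-gap : ∀ {u j t s} → j ≤ s → s < t → t < g → iter (depth u + suc s) p u ∉ proj₁ (broken u j t)
  broken-gap {u} {j} {t} {s} j≤s s<t t<g v∈ with ∈-broken⁻ {u} {j} {t} t<g v∈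
  ... | k , eq , k-range with k <? depth u
  ... | yes k<d = depth-minimal u k<d (subst Cyclic eq (subst Cyclic (sym (beyond-depth u (suc s))) (⊑-trans p (depth-cyclic u) (suc s , refl))))
  ... | no k≮d = excluded k-range
    where
    i = k ∸ depth u
    d+i≡k : depth u + i ≡ k
    d+i≡k = m+[n∸m]≡n (≮⇒≥ k≮d)
    same : i < g → suc s ≡ i
    same i<g = cyclic-injective (depth-cyclic u) (≤-<-trans s<t t<g) i<g
      (trans (sym (beyond-depth u (suc s))) (trans eq (trans (cong (λ m → iter m p u) (sym d+i≡k)) (beyond-depth u i))))
    excluded : ¬ (k ≤ depth u + j ⊎ (depth u + suc t ≤ k × k < depth u + g))
    excluded (inj₁ k≤) = <⇒≱ (≤-<-trans i≤j (s≤s j≤s)) (≤-reflexive (same (≤-<-trans i≤j (≤-<-trans j≤s (<-trans s<t t<g)))))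
      where
      i≤j : i ≤ j
      i≤j = +-cancelˡ-≤ (depth u) i j (subst (_≤ depth u + j) (sym d+i≡k) k≤)
    excluded (inj₂ (≤k , k<)) = <⇒≱ (s≤s s<t) (≤-trans t≤i (≤-reflexive (sym (same i<g))))
      where
      t≤i : suc t ≤ i
      t≤i = +-cancelˡ-≤ (depth u) (suc t) i (subst (depth u + suc t ≤_) (sym d+i≡k) ≤k)
      i<g : i < g
      i<g = +-cancelˡ-< (depth u) i g (subst (_< depth u + g) (sym d+i≡k) k<)

  -- u is the least vertex, j the position of the sink, and t is read off from the absent positions
  -- j + 1, ..., t. For j = t no vertex is absent, only the arc out of position j.
  broken-injective : ∀ {u j t u′ j′ t′} → u ∈ tops → u′ ∈ tops → j ≤ t → t < g → j′ ≤ t′ → t′ < g →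
    Same (broken u j t) (broken u′ j′ t′) → u ≡ u′ × j ≡ j′ × t ≡ t′
  broken-injective {u} {j} {t} {u′} {j′} {t′} u∈ u′∈ j≤t t<g j′≤t′ t′<g (sink≡ , to , from)
    with tops-antisym u∈ u′∈ (broken-below {u} {j} {t} t<g (from (broken-top u′ j′ t′)))
                             (broken-below {u′} {j′} {t′} t′<g (to (broken-top u j t)))
  ... | refl with cyclic-injective (depth-cyclic u) (≤-<-trans j≤t t<g) (≤-<-trans j′≤t′ t′<g)
                    (trans (sym (beyond-depth u j)) (trans (MaybeP.just-injective sink≡) (beyond-depth u j′)))
  ... | refl with <-cmp t t′
  ... | tri≈ _ t≡t′ _ = refl , refl , t≡t′
  ... | tri< t<t′ _ _ = contradiction
    (to (∈-broken⁺ {u} {j} {t} (depth u + suc t) (inj₂ (≤-refl , +-monoʳ-< (depth u) (≤-<-trans t<t′ t′<g)))))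
    (broken-gap {u} {j} {t′} {t} j≤t t<t′ t′<g)
  ... | tri> _ _ t′<t = contradiction
    (from (∈-broken⁺ {u} {j} {t′} (depth u + suc t′) (inj₂ (≤-refl , +-monoʳ-< (depth u) (≤-<-trans t′<t t<g)))))
    (broken-gap {u} {j} {t} {t′} j′≤t′ t′<t t<g)

  whole-valid : ∀ u → Valid (whole u)
  whole-valid u = record
    { hub = o ; hub∈ = ∈-orbit⁺ (reaches u) ; to-hub = λ {v} _ → reaches v
    ; closed = λ v∈ _ → orbit-closed {u} v∈ ; sink = λ () }

  whole-injective : ∀ {u u′} → u ∈ tops → u′ ∈ tops → Same (whole u) (whole u′) → u ≡ u′
  whole-injective u∈ u′∈ (_ , to , from) = tops-antisym u∈ u′∈
    (∈-orbit⁻ (from (∈-orbit⁺ (⊑-refl p)))) (∈-orbit⁻ (to (∈-orbit⁺ (⊑-refl p))))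

  ∈-segment⁻ : ∀ {i j v} → i ≤ j → v ∈ proj₁ (segment i j) → ∃ λ k → v ≡ iter k p o × suc i ≤ k × k ≤ suc j
  ∈-segment⁻ {i} {j} i≤j v∈ with ∈-applyUpTo⁻ (λ k → iter (suc i + k) p o) v∈
  ... | k , s≤s k≤ , refl = suc i + k , refl , m≤m+n (suc i) k , s≤s (subst (i + k ≤_) (m+[n∸m]≡n i≤j) (+-monoʳ-≤ i k≤))

  ∈-segment⁺ : ∀ {i j k} → suc i ≤ k → k ≤ suc j → iter k p o ∈ proj₁ (segment i j)
  ∈-segment⁺ {i} {j} {k} ≤k k≤ = subst (_∈ proj₁ (segment i j)) (cong (λ m → iter m p o) (m+[n∸m]≡n ≤k))
    (∈-applyUpTo⁺ (λ k → iter (suc i + k) p o) (s≤s (∸-monoˡ-≤ (suc i) k≤)))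

  segment-valid : ∀ {i j} → i ≤ j → Valid (segment i j)
  segment-valid {i} {j} i≤j = record
    { hub = iter (suc j) p o ; hub∈ = ∈-segment⁺ (s≤s i≤j) ≤-refl ; to-hub = λ _ → ≼-cyclic (suc j , refl)
    ; closed = next ; sink = λ { refl → refl } }
    where
    next : ∀ {v} → v ∈ proj₁ (segment i j) → just (iter (suc j) p o) ≢ just v → p v ∈ proj₁ (segment i j)
    next v∈ ≢sink with ∈-segment⁻ i≤j v∈
    ... | k , refl , ≤k , k≤ = ∈-segment⁺ {i} {j} {suc k} (m≤n⇒m≤1+n ≤k) (≤∧≢⇒< k≤ λ { refl → ≢sink refl })

  segment-topless : ∀ {u i j} → i ≤ j → suc j < g → u ∈ tops → u ∉ proj₁ (segment i j)
  segment-topless i≤j j<g u∈ v∈ with ∈-segment⁻ i≤j v∈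
  ... | k , refl , ≤k , k≤ = minimal (≤-trans (s≤s z≤n) ≤k) (≤-<-trans k≤ j<g) (cyclic-top u∈ (k , refl))

  segment-injective : ∀ {i j i′ j′} → i ≤ j → suc j < g → i′ ≤ j′ → suc j′ < g →
    Same (segment i j) (segment i′ j′) → i ≡ i′ × j ≡ j′
  segment-injective {i} {j} {i′} {j′} i≤j j<g i′≤j′ j′<g (sink≡ , to , from)
    with cyclic-injective (⊑-refl p) j<g j′<g (MaybeP.just-injective sink≡)
  ... | refl = ≤-antisym (start i′≤j′ i≤j (from (∈-segment⁺ {i′} {j} ≤-refl (s≤s i′≤j′))))
                         (start i≤j i′≤j′ (to (∈-segment⁺ {i} {j} ≤-refl (s≤s i≤j)))) , refl
    where
    start : ∀ {i i′} → i ≤ j → i′ ≤ j → iter (suc i) p o ∈ proj₁ (segment i′ j) → i′ ≤ i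
    start i≤j i′≤j v∈ with ∈-segment⁻ i′≤j v∈
    ... | k , eq , ≤k , k≤ with cyclic-injective (⊑-refl p) (≤-<-trans (s≤s i≤j) j<g) (≤-<-trans k≤ j<g) eq
    ... | refl = ≤-pred ≤k

  join-valid : ∀ {u v c} → Join u v c → Valid c
  join-valid (chain {a} {b} _ (k , eq)) = record
    { hub = b ; hub∈ = subst (_∈ path a k) eq (∈-applyUpTo⁺ (λ i → iter i p a) (n<1+n k)) ; to-hub = below
    ; closed = next ; sink = λ { refl → refl } }
    where
    below : ∀ {v} → v ∈ path a k → v ≼ b
    below v∈ with ∈-applyUpTo⁻ (λ i → iter i p a) v∈
    ... | i , s≤s i≤k , refl = k ∸ i , trans (sym (iter-∸ p a i≤k)) eq
    next : ∀ {v} → v ∈ path a k → just b ≢ just v → p v ∈ path a k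
    next v∈ ≢sink with ∈-applyUpTo⁻ (λ i → iter i p a) v∈
    ... | i , s≤s i≤k , refl = ∈-applyUpTo⁺ (λ i → iter i p a) (s≤s (≤∧≢⇒< i≤k λ { refl → ≢sink (cong just (sym eq)) }))
  join-valid {u} {v} (fork _ _) = record
    { hub = o ; hub∈ = ∈-++⁺ˡ (∈-orbit⁺ (reaches u)) ; to-hub = λ {w} _ → reaches w ; closed = next ; sink = λ () }
    where
    next : ∀ {w} → w ∈ orbit u ++ orbit v → nothing ≢ just w → p w ∈ orbit u ++ orbit v
    next w∈ _ with ∈-++⁻ (orbit u) w∈
    ... | inj₁ w∈u = ∈-++⁺ˡ (orbit-closed {u} w∈u)
    ... | inj₂ w∈v = ∈-++⁺ʳ (orbit u) (orbit-closed {v} w∈v)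

  private
    off-antisym : ∀ {u v} → u ∈ off → u ≼ v → v ≼ u → u ≡ v
    off-antisym u∈ u≼v v≼u with ≼-antisym u≼v v≼u
    ... | inj₁ eq = eq
    ... | inj₂ c = contradiction c (∈-off⁻ u∈)

    path-top : ∀ a k → a ∈ path a k
    path-top a k = ∈-applyUpTo⁺ (λ i → iter i p a) (s≤s z≤n)

    path-below : ∀ {a k v} → v ∈ path a k → a ≼ v
    path-below {a} v∈ with ∈-applyUpTo⁻ (λ i → iter i p a) v∈
    ... | i , _ , refl = i , refl

    ≋-off : ∀ {a b u v} → (a , b) ≋ (u , v) → u ∈ off → v ∈ off → a ∈ off × b ∈ off
    ≋-off (inj₁ (refl , refl)) u∈ v∈ = u∈ , v∈
    ≋-off (inj₂ (refl , refl)) u∈ v∈ = v∈ , u∈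

    ≋-common : ∀ {A : Set} {q r s : A × A} → q ≋ r → q ≋ s → r ≋ s
    ≋-common (inj₁ (refl , refl)) q≋s = q≋s
    ≋-common (inj₂ (refl , refl)) (inj₁ (refl , refl)) = inj₂ (refl , refl)
    ≋-common (inj₂ (refl , refl)) (inj₂ (refl , refl)) = inj₁ (refl , refl)

    fork-minimal : ∀ {u v x} → u ∈ off → ¬ v ≼ u → x ≼ u → x ∈ orbit u ++ orbit v → u ≡ x
    fork-minimal {u} u∈ v⋠u x≼u x∈ with ∈-++⁻ (orbit u) x∈
    ... | inj₁ x∈u = off-antisym u∈ (∈-orbit⁻ x∈u) x≼u
    ... | inj₂ x∈v = contradiction (⊑-trans p (∈-orbit⁻ x∈v) x≼u) v⋠u

    fork-top : ∀ {u v u′ v′} → u ∈ off → ¬ v ≼ u →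
      (∀ {w} → w ∈ orbit u ++ orbit v → w ∈ orbit u′ ++ orbit v′) →
      (∀ {w} → w ∈ orbit u′ ++ orbit v′ → w ∈ orbit u ++ orbit v) → u ≡ u′ ⊎ u ≡ v′
    fork-top {u} {v} {u′} {v′} u∈ v⋠u to from with ∈-++⁻ (orbit u′) (to (∈-++⁺ˡ (∈-orbit⁺ (⊑-refl p))))
    ... | inj₁ u∈u′ = inj₁ (fork-minimal u∈ v⋠u (∈-orbit⁻ u∈u′) (from (∈-++⁺ˡ (∈-orbit⁺ (⊑-refl p)))))
    ... | inj₂ u∈v′ = inj₂ (fork-minimal u∈ v⋠u (∈-orbit⁻ u∈v′) (from (∈-++⁺ʳ (orbit u′) (∈-orbit⁺ (⊑-refl p)))))

    swap-++ : ∀ {xs ys : List (Fin n)} {w} → w ∈ xs ++ ys → w ∈ ys ++ xs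
    swap-++ {xs} {ys} w∈ with ∈-++⁻ xs w∈
    ... | inj₁ w∈xs = ∈-++⁺ʳ ys w∈xs
    ... | inj₂ w∈ys = ∈-++⁺ˡ w∈ys

  -- A chain is recovered from its sink and its least vertex, a fork from its two minimal vertices.
  join-injective : ∀ {u v u′ v′ c c′} → u ∈ off → v ∈ off → u′ ∈ off → v′ ∈ off →
    Join u v c → Join u′ v′ c′ → Same c c′ → (u , v) ≋ (u′ , v′)
  join-injective u∈ v∈ u′∈ v′∈ (chain {a} {b} ab (k , _)) (chain {a′} ab′ (k′ , _)) (refl , to , from)
    with off-antisym (proj₁ (≋-off ab u∈ v∈)) (path-below (from (path-top a′ k′))) (path-below (to (path-top a k)))
  ... | refl = ≋-common ab ab′
  join-injective u∈ v∈ u′∈ v′∈ (chain _ _) (fork _ _) (() , _)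
  join-injective u∈ v∈ u′∈ v′∈ (fork _ _) (chain _ _) (() , _)
  join-injective {u} {v} {u′} {v′} u∈ v∈ u′∈ v′∈ (fork u⋠v v⋠u) (fork _ _) (_ , to , from)
    with fork-top {u} {v} {u′} {v′} u∈ v⋠u to from
       | fork-top {v} {u} {u′} {v′} v∈ u⋠v (λ {w} w∈ → to (swap-++ {orbit v} w∈)) (λ {w} w∈ → swap-++ {orbit u} (from w∈))
  ... | inj₁ eq | inj₂ eq′ = inj₁ (eq , eq′)
  ... | inj₂ eq | inj₁ eq′ = inj₂ (eq , eq′)
  ... | inj₁ refl | inj₁ refl = contradiction (⊑-refl p) u⋠v
  ... | inj₂ refl | inj₂ refl = contradiction (⊑-refl p) u⋠v

  join-sink : ∀ {u v c r} → u ∈ off → v ∈ off → Join u v c → proj₂ c ≡ just r → ¬ Cyclic r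
  join-sink u∈ v∈ (chain ab _) refl = ∈-off⁻ (proj₂ (≋-off ab u∈ v∈))

  -- This separates forks, and later the spanning tree, from codes that have a least vertex.
  no-fork-below : ∀ {x u v} → ¬ u ≼ v → ¬ v ≼ u → x ≼ u → ¬ (x ≼ v)
  no-fork-below u⋠v v⋠u x≼u x≼v with ⊑-total p x≼u x≼v
  ... | inj₁ h = u⋠v h
  ... | inj₂ h = v⋠u h

  -- The four families of the lower bound, their disjointness and their number.

  private
    brokens wholes segments joins codes : List Sub
    brokens = map (λ (u , j , t) → broken u j t) (cartesianProduct tops (pairs (upTo g)))
    wholes = map whole tops
    segments = map (λ (i , j) → segment i j) (pairs (upTo (g ∸ 1)))
    joins = map (λ (u , v) → join u v) (pairs off)
    codes = brokens ++ wholes ++ segments ++ joins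

    IsBroken IsWhole IsSegment IsJoin : Sub → Set
    IsBroken c = ∃ λ u → ∃₂ λ j t → u ∈ tops × j ≤ t × t < g × c ≡ broken u j t
    IsWhole c = ∃ λ u → c ≡ whole u
    IsSegment c = ∃₂ λ i j → i ≤ j × suc j < g × c ≡ segment i j
    IsJoin c = ∃₂ λ u v → u ∈ off × v ∈ off × Join u v c

    index⁻ : ∀ {u j t} → (u , j , t) ∈ cartesianProduct tops (pairs (upTo g)) → u ∈ tops × j ≤ t × t < g
    index⁻ ijt∈ with ∈-cartesianProduct⁻ tops (pairs (upTo g)) ijt∈
    ... | u∈ , jt∈ = u∈ , pairs-upTo⁻ g jt∈

    arc-index⁻ : ∀ {i j} → (i , j) ∈ pairs (upTo (g ∸ 1)) → i ≤ j × suc j < g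
    arc-index⁻ {i} {j} ij∈ with pairs-upTo⁻ (g ∸ 1) ij∈
    ... | i≤j , j< = i≤j , subst (suc j <_) (m+[n∸m]≡n 0<g) (s≤s j<)

    brokens⁻ : ∀ {c} → c ∈ brokens → IsBroken c
    brokens⁻ c∈ with ∈-map⁻ _ c∈
    ... | (u , j , t) , i∈ , eq with index⁻ i∈
    ... | u∈ , j≤t , t<g = u , j , t , u∈ , j≤t , t<g , eq

    wholes⁻ : ∀ {c} → c ∈ wholes → IsWhole c
    wholes⁻ c∈ with ∈-map⁻ whole c∈
    ... | u , _ , eq = u , eq

    segments⁻ : ∀ {c} → c ∈ segments → IsSegment c
    segments⁻ c∈ with ∈-map⁻ _ c∈
    ... | (i , j) , ij∈ , eq with arc-index⁻ ij∈
    ... | i≤j , j<g = i , j , i≤j , j<g , eq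

    joins⁻ : ∀ {c} → c ∈ joins → IsJoin c
    joins⁻ c∈ with ∈-map⁻ _ c∈
    ... | (u , v) , uv∈ , refl with ∈-pairs⁻ off uv∈
    ... | u∈ , v∈ = u , v , u∈ , v∈ , join-view u v

    broken-cyclic-sink : ∀ u j → Cyclic (iter (depth u + j) p u)
    broken-cyclic-sink u j = subst Cyclic (sym (beyond-depth u j)) (⊑-trans p (depth-cyclic u) (j , refl))

    broken≁whole : ∀ {c c′} → IsBroken c → IsWhole c′ → ¬ Same c c′
    broken≁whole (_ , _ , _ , _ , _ , _ , refl) (_ , refl) (() , _)

    broken≁segment : ∀ {c c′} → IsBroken c → IsSegment c′ → ¬ Same c c′
    broken≁segment (u , j , t , u∈ , _ , _ , refl) (_ , _ , i≤j , j<g , refl) (_ , to , _) =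
      segment-topless i≤j j<g u∈ (to (broken-top u j t))

    cyclic-sink≁join : ∀ {vs r c} → Cyclic r → IsJoin c → ¬ Same (vs , just r) c
    cyclic-sink≁join cyc (u , v , u∈ , v∈ , J) (eq , _) = join-sink u∈ v∈ J (sym eq) cyc

    whole≁segment : ∀ {c c′} → IsWhole c → IsSegment c′ → ¬ Same c c′
    whole≁segment (_ , refl) (_ , _ , _ , _ , refl) (() , _)

    whole≁join : ∀ {c c′} → IsWhole c → IsJoin c′ → ¬ Same c c′
    whole≁join (_ , refl) (_ , _ , _ , _ , chain _ _) (() , _)
    whole≁join (x , refl) (u , v , _ , _ , fork u⋠v v⋠u) (_ , _ , from) = no-fork-below u⋠v v⋠u
      (∈-orbit⁻ (from (∈-++⁺ˡ (∈-orbit⁺ (⊑-refl p)))))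
      (∈-orbit⁻ (from (∈-++⁺ʳ (orbit u) (∈-orbit⁺ (⊑-refl p)))))

    -- The sink tells the families apart: wholes have none, brokens and segments a cyclic one, joins
    -- one off the cycle or none. Between the rest, brokens contain a top while segments contain
    -- none, and wholes have a least vertex while forks do not.
    codes-apart : AllPairs (λ c c′ → ¬ Same c c′) codes
    codes-apart = AllPairsP.++⁺ brokens-apart (AllPairsP.++⁺ wholes-apart (AllPairsP.++⁺ segments-apart joins-apart
        (All.tabulate λ s∈ → All.tabulate λ j∈ → segment≁join (segments⁻ s∈) (joins⁻ j∈)))
        (All.tabulate λ w∈ → All.tabulate λ r∈ → whole≁rest (wholes⁻ w∈) (∈-++⁻ segments r∈)))
        (All.tabulate λ b∈ → All.tabulate λ r∈ → broken≁rest (brokens⁻ b∈) (∈-++⁻ wholes r∈))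
      where
      segment≁join : ∀ {c c′} → IsSegment c → IsJoin c′ → ¬ Same c c′
      segment≁join (_ , j , _ , _ , refl) J = cyclic-sink≁join (suc j , refl) J
      whole≁rest : ∀ {c c′} → IsWhole c → c′ ∈ segments ⊎ c′ ∈ joins → ¬ Same c c′
      whole≁rest W (inj₁ s∈) = whole≁segment W (segments⁻ s∈)
      whole≁rest W (inj₂ j∈) = whole≁join W (joins⁻ j∈)
      broken≁rest : ∀ {c c′} → IsBroken c → c′ ∈ wholes ⊎ c′ ∈ segments ++ joins → ¬ Same c c′
      broken≁rest B (inj₁ w∈) = broken≁whole B (wholes⁻ w∈)
      broken≁rest B (inj₂ r∈) with ∈-++⁻ segments r∈
      ... | inj₁ s∈ = broken≁segment B (segments⁻ s∈)
      broken≁rest (u , j , t , _ , _ , _ , refl) (inj₂ r∈) | inj₂ j∈ = cyclic-sink≁join (broken-cyclic-sink u j) (joins⁻ j∈)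
      brokens-apart : AllPairs (λ c c′ → ¬ Same c c′) brokens
      brokens-apart = AllPairsP.map⁺ (allPairs-∈
        (UniqueP.cartesianProduct⁺ tops-unique (pairs-unique (UniqueP.upTo⁺ g)))
        λ x∈ y∈ x≢y same → x≢y (eq (index⁻ x∈) (index⁻ y∈) same))
        where
        eq : ∀ {u j t u′ j′ t′} → u ∈ tops × j ≤ t × t < g → u′ ∈ tops × j′ ≤ t′ × t′ < g →
          Same (broken u j t) (broken u′ j′ t′) → (u , j , t) ≡ (u′ , j′ , t′)
        eq {u} {j} {t} {u′} {j′} {t′} (a , b , c) (a′ , b′ , c′) same
          with broken-injective {u} {j} {t} {u′} {j′} {t′} a a′ b c b′ c′ same
        ... | refl , refl , refl = refl
      wholes-apart : AllPairs (λ c c′ → ¬ Same c c′) wholes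
      wholes-apart = AllPairsP.map⁺ (allPairs-∈ tops-unique λ u∈ v∈ u≢v same → u≢v (whole-injective u∈ v∈ same))
      segments-apart : AllPairs (λ c c′ → ¬ Same c c′) segments
      segments-apart = AllPairsP.map⁺ (allPairs-∈ (pairs-unique (UniqueP.upTo⁺ (g ∸ 1)))
        λ x∈ y∈ x≢y same → x≢y (eq (arc-index⁻ x∈) (arc-index⁻ y∈) same))
        where
        eq : ∀ {i j i′ j′} → i ≤ j × suc j < g → i′ ≤ j′ × suc j′ < g → Same (segment i j) (segment i′ j′) → (i , j) ≡ (i′ , j′)
        eq {i} {j} {i′} {j′} (a , b) (a′ , b′) same with segment-injective {i} {j} {i′} {j′} a b a′ b′ same
        ... | refl , refl = refl
      joins-apart : AllPairs (λ c c′ → ¬ Same c c′) joins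
      joins-apart = AllPairsP.map⁺ (allPairs-∈ (pairs-distinct off-unique) λ {x} {y} x∈ y∈ ≄ same →
        ≄ (join-injective (proj₁ (∈-pairs⁻ off x∈)) (proj₂ (∈-pairs⁻ off x∈)) (proj₁ (∈-pairs⁻ off y∈)) (proj₂ (∈-pairs⁻ off y∈))
          (join-view (proj₁ x) (proj₂ x)) (join-view (proj₁ y) (proj₂ y)) same))

    codes-valid : ∀ {c} → c ∈ codes → Valid c
    codes-valid c∈ with ∈-++⁻ brokens c∈
    ... | inj₁ b∈ with brokens⁻ b∈
    ... | u , j , t , _ , _ , t<g , refl = broken-valid {u} {j} {t} t<g
    codes-valid c∈ | inj₂ r∈ with ∈-++⁻ wholes r∈
    ... | inj₁ w∈ with wholes⁻ w∈
    ... | u , refl = whole-valid u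
    codes-valid c∈ | inj₂ r∈ | inj₂ r∈′ with ∈-++⁻ segments r∈′
    ... | inj₁ s∈ with segments⁻ s∈
    ... | i , j , i≤j , _ , refl = segment-valid i≤j
    codes-valid c∈ | inj₂ r∈ | inj₂ r∈′ | inj₂ j∈ with joins⁻ j∈
    ... | _ , _ , _ , _ , J = join-valid J

    length-codes : 2 * length codes ≡ (n ∸ g) * (n + g * g + 3) + 2 * (g * g + 1)
    length-codes = begin
      2 * length codes
        ≡⟨ cong (2 *_) (trans (length-++ brokens) (cong₂ _+_ 
             (trans (length-map (λ (u , j , t) → broken u j t) (cartesianProduct tops (pairs (upTo g))))
               (length-cartesianProduct tops (pairs (upTo g))))
             (trans (length-++ wholes) (cong₂ _+_ (length-map whole tops)
               (trans (length-++ segments) (cong₂ _+_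
                 (length-map (λ (i , j) → segment i j) (pairs (upTo (g ∸ 1)))) (length-map (λ (u , v) → join u v) (pairs off)))))))) ⟩
      2 * (suc m * B + (suc m + (C + D)))
        ≡⟨ expand m B C D ⟩
      suc m * (2 * B) + 2 * suc m + 2 * C + 2 * D
        ≡⟨ cong₂ _+_ (cong₂ _+_ (cong (λ b → suc m * b + 2 * suc m) (tri g)) (tri (g ∸ 1))) (length-pairs off) ⟩
      suc m * (g * suc g) + 2 * suc m + (g ∸ 1) * suc (g ∸ 1) + m * suc m
        ≡⟨ total 0<g ⟩
      m * (g + m + g * g + 3) + 2 * (g * g + 1)
        ≡⟨ cong₂ (λ a b → a * (b + g * g + 3) + 2 * (g * g + 1)) (trans (sym (m+n∸m≡n g m)) (cong (_∸ g) length-off)) length-off ⟩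
      (n ∸ g) * (n + g * g + 3) + 2 * (g * g + 1) ∎
      where
      open ≡-Reasoning
      m = length off
      B = length (pairs (upTo g))
      C = length (pairs (upTo (g ∸ 1)))
      D = length (pairs off)
      tri : ∀ k → 2 * length (pairs (upTo k)) ≡ k * suc k
      tri k = trans (length-pairs (upTo k)) (cong (λ l → l * suc l) (length-upTo k))
      expand : ∀ m B C D → 2 * (suc m * B + (suc m + (C + D))) ≡ suc m * (2 * B) + 2 * suc m + 2 * C + 2 * D
      expand = solve-∀
      -- Writing g = k + 1 removes the truncated subtraction and leaves a polynomial identity.
      total : ∀ {g} → 0 < g → suc m * (g * suc g) + 2 * suc m + (g ∸ 1) * suc (g ∸ 1) + m * suc m
                              ≡ m * (g + m + g * g + 3) + 2 * (g * g + 1)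
      total {suc k} _ = poly m k
        where
        poly : ∀ m k → suc m * (suc k * suc (suc k)) + 2 * suc m + k * suc k + m * suc m
                     ≡ m * (suc k + m + suc k * suc k + 3) + 2 * (suc k * suc k + 1)
        poly = solve-∀

  lower-bound : (n ∸ g) * (n + g * g + 3) + 2 * (g * g + 1) ≤ 2 * F G
  lower-bound = subst (_≤ 2 * F G) length-codes (*-monoʳ-≤ 2 (≤F-valid codes codes-valid codes-apart))

  -- Two incomparable tails leave the spanning tree without the arc of o uncounted.
  strict-lower-bound : ∀ {u v} → ¬ u ≼ v → ¬ v ≼ u → (n ∸ g) * (n + g * g + 3) + 2 * (g * g + 1) < 2 * F G
  strict-lower-bound {u} {v} u⋠v v⋠u = subst (_< 2 * F G) length-codes (*-monoʳ-< 2
    (≤F-valid (spanning ∷ codes) (λ { (here refl) → spanning-valid ; (there c∈) → codes-valid c∈ })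
      (All.tabulate spanning≁ ∷ codes-apart)))
    where
    spanning : Sub
    spanning = allFin n , just o
    spanning-valid : Valid spanning
    spanning-valid = record { hub = o ; hub∈ = ∈-allFin o ; to-hub = λ {w} _ → reaches w
                            ; closed = λ {w} _ _ → ∈-allFin (p w) ; sink = λ { refl → refl } }
    -- The cyclic sink excludes wholes and joins, the vertex `o` excludes segments, and the least
    -- vertex of a broken would be a common lower bound of u and v.
    spanning≁ : ∀ {c} → c ∈ codes → ¬ Same spanning c
    spanning≁ c∈ same@(_ , to , _) with ∈-++⁻ brokens c∈
    ... | inj₁ b∈ with brokens⁻ b∈
    ... | x , j , t , _ , _ , t<g , refl = no-fork-below u⋠v v⋠u
      (broken-below {x} {j} {t} t<g (to (∈-allFin u))) (broken-below {x} {j} {t} t<g (to (∈-allFin v)))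
    spanning≁ c∈ same@(_ , to , _) | inj₂ r∈ with ∈-++⁻ wholes r∈
    ... | inj₁ w∈ with wholes⁻ w∈ | same
    ... | _ , refl | () , _
    spanning≁ c∈ same@(_ , to , _) | inj₂ r∈ | inj₂ r∈′ with ∈-++⁻ segments r∈′
    ... | inj₁ s∈ with segments⁻ s∈
    ... | i , j , i≤j , j<g , refl = segment-topless i≤j j<g (here refl) (to (∈-allFin o))
    spanning≁ c∈ same@(_ , to , _) | inj₂ r∈ | inj₂ r∈′ | inj₂ j∈ = cyclic-sink≁join (⊑-refl p) (joins⁻ j∈) same

-- The upper bound for lollipops

-- h numbers the vertices as in the lollipop: p moves one step down, and from 0 to g − 1.
record Chain {n} (g : ℕ) (p : Fin n → Fin n) : Set where
  field
    h         : Fin n → ℕ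
    h<n       : ∀ v → h v < n
    h-inj     : ∀ {u v} → h u ≡ h v → u ≡ v
    h-surj    : ∀ {k} → k < n → ∃ λ v → h v ≡ k
    h-suc     : ∀ {v k} → h v ≡ suc k → h (p v) ≡ k
    h-zero    : ∀ {v} → h v ≡ 0 → h (p v) ≡ g ∸ 1

module UpperBound {n g} {G : Graph n} (simple : IsSimple G) {p : Fin n → Fin n}
                  (rep : Represents G p) (0<g : 0 < g) (g<n : g < n) (chain : Chain g p) where
  open Chain chain

  highest : ∀ {Q : Fin n → Set} → Decidable Q → ∃ Q → ∃ λ x → Q x × (∀ {y} → Q y → h y ≤ h x)
  highest {Q} Q? (x , qx) = climb n x qx (m≤m+n n (h x))
    where
    -- Here k bounds the climbs still possible, since heights stay below n.
    climb : ∀ k x → Q x → n ≤ k + h x → ∃ λ x → Q x × (∀ {y} → Q y → h y ≤ h x)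
    climb zero x _ n≤ = contradiction (h<n x) (≤⇒≯ n≤)
    climb (suc k) x qx n≤ with any? (λ y → Q? y ×-dec (h x <? h y))
    ... | yes (y , qy , x<y) = climb k y qy (≤-trans n≤ (≤-trans (≤-reflexive (sym (+-suc k (h x)))) (+-monoʳ-≤ k x<y)))
    ... | no none = x , qx , λ {y} qy → ≮⇒≥ λ x<y → none (y , qy , x<y)

  private
    Pair : Set
    Pair = (Fin n → Bool) × (Fin n → Bool)

    Within : ℕ → ℕ → ℕ → Fin n → Set
    Within s a t v = h v < s ⊎ (a ≤ h v × h v ≤ t)

    within? : ∀ s a t v → Dec (Within s a t v)
    within? s a t v = (h v <? s) ⊎-dec ((a ≤? h v) ×-dec (h v ≤? t))

    -- Vertices of height below s or in [a , t]; arcs from heights below s or in [b , t].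
    block : ℕ → ℕ → ℕ → ℕ → Pair
    block s a b t = (λ v → ⌊ within? s a t v ⌋) , (λ v → ⌊ within? s b t v ⌋)

    -- The kinds are: heights a ... t with sink a; heights 0 ... s and a + 1 ... g - 1 + t with s ≤
    -- a and sink a + 1, the two parts linked by the arc from height 0 to g - 1; and all heights up
    -- to g - 1 + t without a sink. The highest vertex g - 1 + t of the last two kinds ranges over g
    -- - 1, ..., n - 1.
    intervals brokens wholes codes : List Pair
    intervals = map (λ (a , t) → block 0 a (suc a) t) (pairs (upTo n))
    brokens = map (λ ((s , a) , t) → block (suc s) (suc a) (suc (suc a)) (g ∸ 1 + t))
                  (cartesianProduct (pairs (upTo (g ∸ 1))) (upTo (suc (n ∸ g))))
    wholes = map (λ t → block 0 0 0 (g ∸ 1 + t)) (upTo (suc (n ∸ g)))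
    codes = intervals ++ brokens ++ wholes

    Listed : (V S : Fin n → Bool) → Set
    Listed V S = ∃ λ c → c ∈ codes × (∀ v → V v ≡ proj₁ c v) × (∀ v → S v ≡ proj₂ c v)

    matches : ∀ {V : Fin n → Bool} s a t → (∀ {v} → V v ≡ true → Within s a t v) →
      (∀ {v} → Within s a t v → V v ≡ true) → ∀ v → V v ≡ ⌊ within? s a t v ⌋
    matches s a t to from v = ⇔-true (does-true⁺ (within? s a t v) ∘ to) (from ∘ does-true⁻ (within? s a t v))

    g∸1-top : ∀ {t} → g ∸ 1 ≤ t → t < n → t ∸ (g ∸ 1) ∈ upTo (suc (n ∸ g)) × g ∸ 1 + (t ∸ (g ∸ 1)) ≡ t
    g∸1-top {t} ≤t t<n = ∈-upTo⁺ (subst (t ∸ (g ∸ 1) <_) (n∸ 0<g (<⇒≤ g<n)) (∸-monoˡ-< t<n ≤t)) , m+[n∸m]≡n ≤t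
      where
      n∸ : ∀ {g} → 0 < g → g ≤ n → n ∸ (g ∸ 1) ≡ suc (n ∸ g)
      n∸ {suc g} _ g≤n = +-∸-assoc 1 g≤n

  module _ {V S : Fin n → Bool} (conn : ConnectedPair p V S) where
    open ConnectedPair conn

    private
      descend : ∀ k {x y} → h x ≡ k + h y → V x ≡ true →
        (∀ {v} → V v ≡ true → h y < h v → h v ≤ h x → S v ≡ true) → V y ≡ true
      descend zero eq vx _ = subst (λ v → V v ≡ true) (h-inj eq) vx
      descend (suc k) {x} {y} eq vx arcs = descend k hp (pS⊆V (arcs vx (subst (h y <_) (sym eq) (s≤s (m≤n+m (h y) k))) ≤-refl))
        (λ vv y<v v≤ → arcs vv y<v (≤-trans v≤ (≤-trans (≤-reflexive hp) (≤-trans (n≤1+n _) (≤-reflexive (sym eq))))))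
        where
        hp : h (p x) ≡ k + h y
        hp = h-suc eq

      below : ∀ {x y} → h y ≤ h x → V x ≡ true →
        (∀ {v} → V v ≡ true → h y < h v → h v ≤ h x → S v ≡ true) → V y ≡ true
      below {x} {y} y≤x = descend (h x ∸ h y) (sym (m∸n+n≡m y≤x))

      bottom : Fin n
      bottom = proj₁ (h-surj (<-trans 0<g g<n))

      h-bottom : h bottom ≡ 0
      h-bottom = proj₂ (h-surj (<-trans 0<g g<n))

      bottom≤ : ∀ {v} → h bottom ≤ h v
      bottom≤ = ≤-trans (≤-reflexive h-bottom) z≤n

      -- Nothing stops the descent from the highest vertex to height 0. The arc there puts height g
      -- - 1 into V, so the highest vertex is at least that high.
      wholeCase : (∀ {v} → V v ≡ true → S v ≡ true) → Listed V S
      wholeCase closed with highest (λ v → V v ≟ᵇ true) nonempty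
      ... | x , vx , max with g∸1-top (subst (_≤ h x) (h-zero h-bottom)
                                (max (pS⊆V (closed (below bottom≤ vx (λ vv _ _ → closed vv)))))) (h<n x)
      ... | t∈ , t≡ = _ , ∈-++⁺ʳ intervals (∈-++⁺ʳ brokens (∈-map⁺ _ t∈)) ,
        matches 0 0 _ to from , matches 0 0 _ (to ∘ S⊆V) (closed ∘ from)
        where
        to : ∀ {v} → V v ≡ true → Within 0 0 (g ∸ 1 + (h x ∸ (g ∸ 1))) v
        to {v} vv = inj₂ (z≤n , subst (h v ≤_) (sym t≡) (max vv))
        from : ∀ {v} → Within 0 0 (g ∸ 1 + (h x ∸ (g ∸ 1))) v → V v ≡ true
        from {v} (inj₂ (_ , v≤)) = below (subst (h v ≤_) t≡ v≤) vx (λ vv _ _ → closed vv)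

      module _ {r} (vr : V r ≡ true) (¬sr : S r ≢ true) where

        -- Arrival at r along arcs of S. It passes backwards along an arc by `move`, and forwards
        -- because a vertex with an arc in S is not r, so its derivation begins with that arc. By
        -- connectedness all of V drains, which makes r the only sink.
        data Drains : Fin n → Set where
          stop : Drains r
          move : ∀ {v} → S v ≡ true → Drains (p v) → Drains v

        drains : ∀ {v} → V v ≡ true → Drains v
        drains vv = joined (λ sv → (λ { stop → contradiction sv ¬sr ; (move _ d) → d }) , move sv) vr vv stop

        in-S : ∀ {v} → V v ≡ true → h v ≢ h r → S v ≡ true
        in-S vv ≢r with drains vv
        ... | stop = contradiction refl ≢r
        ... | move sv _ = sv

        S≢r : ∀ {v} → S v ≡ true → h v ≢ h r
        S≢r sv eq with h-inj eq
        ... | refl = ¬sr sv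

        -- Heights below g are those of the cycle and are preserved by p, so a sink into which such
        -- a vertex drains is itself on the cycle.
        low-drains : ∀ {v} → Drains v → h v < g → h r < g
        low-drains stop v<g = v<g
        low-drains {v} (move _ d) v<g with h v in eq
        ... | zero = low-drains d (subst (_< g) (sym (h-zero eq)) (∸-monoʳ-< (s≤s z≤n) 0<g))
        ... | suc k = low-drains d (subst (_< g) (sym (h-suc eq)) (<-trans (n<1+n k) v<g))

        sinkCase : Listed V S
        sinkCase with highest (λ v → V v ≟ᵇ true) nonempty
        ... | x , vx , max with any? (λ v → (V v ≟ᵇ true) ×-dec (h v <? h r))
        ... | no none = _ , ∈-++⁺ˡ (∈-map⁺ _ (pairs-upTo⁺ (max vr) (h<n x))) ,
          matches 0 (h r) (h x) to from , matches 0 (suc (h r)) (h x) toS fromS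
          where
          to : ∀ {v} → V v ≡ true → Within 0 (h r) (h x) v
          to {v} vv = inj₂ (≮⇒≥ (λ v<r → none (v , vv , v<r)) , max vv)
          from : ∀ {v} → Within 0 (h r) (h x) v → V v ≡ true
          from {v} (inj₂ (r≤ , ≤x)) = below ≤x vx (λ vv v< _ → in-S vv (λ eq → <⇒≱ v< (subst (_≤ h v) (sym eq) r≤)))
          toS : ∀ {v} → S v ≡ true → Within 0 (suc (h r)) (h x) v
          toS sv with to (S⊆V sv)
          ... | inj₂ (r≤ , ≤x) = inj₂ (≤∧≢⇒< r≤ (S≢r sv ∘ sym) , ≤x)
          fromS : ∀ {v} → Within 0 (suc (h r)) (h x) v → S v ≡ true
          fromS (inj₂ (r< , ≤x)) = in-S (from (inj₂ (<⇒≤ r< , ≤x))) (>⇒≢ r<)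
        -- `y` is the highest vertex below the sink. The descent from `y` meets no sink, so all
        -- heights from `y` down to 0 are present, and the arc of height 0 leads to g - 1. What is
        -- missing is the gap between `y` and `r`, possibly empty.
        ... | yes low with highest (λ v → (V v ≟ᵇ true) ×-dec (h v <? h r)) low
        ... | y , (vy , y<r) , maxy = listed (h r) refl
          where
          under : ∀ {v} → h v ≤ h y → V v ≡ true
          under v≤y = below v≤y vy (λ vv _ ≤y → in-S vv (<⇒≢ (≤-<-trans ≤y y<r)))
          r<g : h r < g
          r<g = low-drains (drains (under (bottom≤ {y}))) (subst (_< g) (sym h-bottom) 0<g)
          g∸1≤x : g ∸ 1 ≤ h x
          g∸1≤x = subst (_≤ h x) (h-zero h-bottom) (max (pS⊆V (in-S (under (bottom≤ {y})) (<⇒≢ (≤-<-trans (bottom≤ {y}) y<r)))))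
          t : ℕ
          t = g ∸ 1 + (h x ∸ (g ∸ 1))
          t≡ : t ≡ h x
          t≡ = proj₂ (g∸1-top g∸1≤x (h<n x))
          to : ∀ {v} → V v ≡ true → Within (suc (h y)) (h r) t v
          to {v} vv with h v <? h r
          ... | yes v<r = inj₁ (s≤s (maxy (vv , v<r)))
          ... | no v≮r = inj₂ (≮⇒≥ v≮r , subst (h v ≤_) (sym t≡) (max vv))
          from : ∀ {v} → Within (suc (h y)) (h r) t v → V v ≡ true
          from (inj₁ (s≤s v≤y)) = under v≤y
          from {v} (inj₂ (r≤ , ≤t)) = below (subst (h v ≤_) t≡ ≤t) vx (λ vv v< _ → in-S vv (λ eq → <⇒≱ v< (subst (_≤ h v) (sym eq) r≤)))
          toS : ∀ {v} → S v ≡ true → Within (suc (h y)) (suc (h r)) t v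
          toS sv with to (S⊆V sv)
          ... | inj₁ v<s = inj₁ v<s
          ... | inj₂ (r≤ , ≤t) = inj₂ (≤∧≢⇒< r≤ (S≢r sv ∘ sym) , ≤t)
          fromS : ∀ {v} → Within (suc (h y)) (suc (h r)) t v → S v ≡ true
          fromS (inj₁ v<s) = in-S (from (inj₁ v<s)) (<⇒≢ (≤-<-trans (≤-pred v<s) y<r))
          fromS (inj₂ (r< , ≤t)) = in-S (from (inj₂ (<⇒≤ r< , ≤t))) (>⇒≢ r<)
          -- The height of r exceeds that of y and is therefore positive; the code is indexed by its
          -- predecessor.
          listed : ∀ a → h r ≡ a → Listed V S
          listed zero eq = contradiction (subst (h y <_) eq y<r) λ ()
          listed (suc a) eq = block (suc (h y)) (suc a) (suc (suc a)) t ,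
            ∈-++⁺ʳ intervals (∈-++⁺ˡ (∈-map⁺ (λ ((s , a) , t) → block (suc s) (suc a) (suc (suc a)) (g ∸ 1 + t))
              (∈-cartesianProduct⁺ (pairs-upTo⁺ (≤-pred (subst (h y <_) eq y<r)) (∸-monoˡ-< (subst (_< g) eq r<g) (s≤s z≤n)))
                (proj₁ (g∸1-top g∸1≤x (h<n x)))))) ,
            matches (suc (h y)) (suc a) _ (subst (λ b → ∀ {v} → V v ≡ true → Within (suc (h y)) b t v) eq to)
                                          (subst (λ b → ∀ {v} → Within (suc (h y)) b t v → V v ≡ true) eq from) ,
            matches (suc (h y)) (suc (suc a)) _ (subst (λ b → ∀ {v} → S v ≡ true → Within (suc (h y)) (suc b) t v) eq toS)
                                          (subst (λ b → ∀ {v} → Within (suc (h y)) (suc b) t v → S v ≡ true) eq fromS)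

    all-listed : Listed V S
    all-listed with any? (λ r → (V r ≟ᵇ true) ×-dec ¬? (S r ≟ᵇ true))
    ... | yes (r , vr , ¬sr) = sinkCase vr ¬sr
    ... | no none = wholeCase closed
      where
      closed : ∀ {v} → V v ≡ true → S v ≡ true
      closed {v} vv with S v ≟ᵇ true
      ... | yes sv = sv
      ... | no ¬sv = contradiction (v , vv , ¬sv) none

  private
    length-codes : 2 * length codes ≡ (n ∸ g) * (n + g * g + 3) + 2 * (g * g + 1)
    length-codes = begin
      2 * length codes
        ≡⟨ cong (2 *_) (trans (length-++ intervals) (cong₂ _+_ (length-map (λ (a , t) → block 0 a (suc a) t) (pairs (upTo n)))
             (trans (length-++ brokens) (cong₂ _+_
               (trans (length-map (λ ((s , a) , t) → block (suc s) (suc a) (suc (suc a)) (g ∸ 1 + t)) (cartesianProduct (pairs (upTo (g ∸ 1))) (upTo (suc m))))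
                 (trans (length-cartesianProduct (pairs (upTo (g ∸ 1))) (upTo (suc m))) (cong (C *_) (length-upTo (suc m)))))
               (trans (length-map (λ t → block 0 0 0 (g ∸ 1 + t)) (upTo (suc m))) (length-upTo (suc m))))))) ⟩
      2 * (A + (C * suc m + suc m))
        ≡⟨ expand A C m ⟩
      2 * A + (2 * C) * suc m + 2 * suc m
        ≡⟨ cong₂ (λ a c → a + c * suc m + 2 * suc m) (tri n) (tri (g ∸ 1)) ⟩
      n * suc n + ((g ∸ 1) * suc (g ∸ 1)) * suc m + 2 * suc m
        ≡⟨ cong (λ k → k * suc k + ((g ∸ 1) * suc (g ∸ 1)) * suc m + 2 * suc m) (sym g+m≡n) ⟩
      (g + m) * suc (g + m) + ((g ∸ 1) * suc (g ∸ 1)) * suc m + 2 * suc m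
        ≡⟨ total 0<g ⟩
      m * (g + m + g * g + 3) + 2 * (g * g + 1)
        ≡⟨ cong (λ k → m * (k + g * g + 3) + 2 * (g * g + 1)) g+m≡n ⟩
      m * (n + g * g + 3) + 2 * (g * g + 1) ∎
      where
      open ≡-Reasoning
      m = n ∸ g
      A = length (pairs (upTo n))
      C = length (pairs (upTo (g ∸ 1)))
      g+m≡n : g + m ≡ n
      g+m≡n = m+[n∸m]≡n (<⇒≤ g<n)
      tri : ∀ k → 2 * length (pairs (upTo k)) ≡ k * suc k
      tri k = trans (length-pairs (upTo k)) (cong (λ l → l * suc l) (length-upTo k))
      expand : ∀ A C m → 2 * (A + (C * suc m + suc m)) ≡ 2 * A + (2 * C) * suc m + 2 * suc m
      expand = solve-∀
      total : ∀ {g} → 0 < g → (g + m) * suc (g + m) + ((g ∸ 1) * suc (g ∸ 1)) * suc m + 2 * suc m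
                              ≡ m * (g + m + g * g + 3) + 2 * (g * g + 1)
      total {suc k} _ = poly m k
        where
        poly : ∀ m k → (suc k + m) * suc (suc k + m) + (k * suc k) * suc m + 2 * suc m
                     ≡ m * (suc k + m + suc k * suc k + 3) + 2 * (suc k * suc k + 1)
        poly = solve-∀

  upper-bound : 2 * F G ≤ (n ∸ g) * (n + g * g + 3) + 2 * (g * g + 1)
  upper-bound = subst (2 * F G ≤_) length-codes (*-monoʳ-≤ 2 (F≤-pairs simple rep codes all-listed))

-- Recognising lollipops

LolliAdj : ℕ → ℕ → ℕ → Set
LolliAdj g a b = a ≢ b × (suc a ≡ b ⊎ suc b ≡ a ⊎ (a ≡ 0 × b ≡ g ∸ 1) ⊎ (b ≡ 0 × a ≡ g ∸ 1))

lolli-sym : ∀ g {a b} → LolliAdj g a b → LolliAdj g b a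
lolli-sym g (≢ , inj₁ e) = (≢ ∘ sym) , inj₂ (inj₁ e)
lolli-sym g (≢ , inj₂ (inj₁ e)) = (≢ ∘ sym) , inj₁ e
lolli-sym g (≢ , inj₂ (inj₂ (inj₁ e))) = (≢ ∘ sym) , inj₂ (inj₂ (inj₂ e))
lolli-sym g (≢ , inj₂ (inj₂ (inj₂ e))) = (≢ ∘ sym) , inj₂ (inj₂ (inj₁ e))

module _ {n} (g : ℕ) {i j : Fin n} where

  private
    ≡ᵇ⁻ : ∀ {a b} → (a ≡ᵇ b) ≡ true → a ≡ b
    ≡ᵇ⁻ {a} {b} eq = ≡ᵇ⇒≡ a b (subst T (sym eq) _)

    ≡ᵇ⁺ : ∀ {a b} → a ≡ b → (a ≡ᵇ b) ≡ true
    ≡ᵇ⁺ {a} {b} eq = Equivalence.to T-≡ (≡⇒≡ᵇ a b eq)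

  lollipop⁻ : lollipop n g i j ≡ true → LolliAdj g (toℕ i) (toℕ j)
  lollipop⁻ eq with i ≟ j
  ... | no i≢j = i≢j ∘ toℕ-injective , cases (∨-true⁻ eq)
    where
    cases : _ → _
    cases (inj₁ h) = inj₁ (≡ᵇ⁻ h)
    cases (inj₂ h) with ∨-true⁻ h
    ... | inj₁ h′ = inj₂ (inj₁ (≡ᵇ⁻ h′))
    ... | inj₂ h′ with ∨-true⁻ {(toℕ i ≡ᵇ 0) ∧ (toℕ j ≡ᵇ g ∸ 1)} h′
    ... | inj₁ h″ with ∧-true⁻ {toℕ i ≡ᵇ 0} h″
    ... | a , b = inj₂ (inj₂ (inj₁ (≡ᵇ⁻ a , ≡ᵇ⁻ b)))
    cases (inj₂ h) | inj₂ h′ | inj₂ h″ with ∧-true⁻ {toℕ j ≡ᵇ 0} h″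
    ... | a , b = inj₂ (inj₂ (inj₂ (≡ᵇ⁻ a , ≡ᵇ⁻ b)))

  lollipop⁺ : LolliAdj g (toℕ i) (toℕ j) → lollipop n g i j ≡ true
  lollipop⁺ (i≢j , c) with i ≟ j
  ... | yes refl = contradiction refl i≢j
  ... | no _ = cases c
    where
    cases : _ → _
    cases (inj₁ h) = ∨-trueˡ (≡ᵇ⁺ h)
    cases (inj₂ (inj₁ h)) = ∨-trueʳ {suc (toℕ i) ≡ᵇ toℕ j} (∨-trueˡ (≡ᵇ⁺ h))
    cases (inj₂ (inj₂ (inj₁ (a , b)))) = ∨-trueʳ {suc (toℕ i) ≡ᵇ toℕ j} (∨-trueʳ {suc (toℕ j) ≡ᵇ toℕ i}
      (∨-trueˡ (∧-true⁺ (≡ᵇ⁺ a) (≡ᵇ⁺ b))))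
    cases (inj₂ (inj₂ (inj₂ (a , b)))) = ∨-trueʳ {suc (toℕ i) ≡ᵇ toℕ j} (∨-trueʳ {suc (toℕ j) ≡ᵇ toℕ i}
      (∨-trueʳ {(toℕ i ≡ᵇ 0) ∧ (toℕ j ≡ᵇ g ∸ 1)} (∧-true⁺ (≡ᵇ⁺ a) (≡ᵇ⁺ b))))

lollipop-simple : ∀ n g → IsSimple (lollipop n g)
lollipop-simple n g = (λ i j → ⇔-true (swap i j) (swap j i)) , loopless
  where
  swap : ∀ i j → lollipop n g i j ≡ true → lollipop n g j i ≡ true
  swap i j adj = lollipop⁺ g (lolli-sym g (lollipop⁻ g {i} {j} adj))
  loopless : ∀ i → lollipop n g i i ≡ false
  loopless i with lollipop n g i i in eq
  ... | false = refl
  ... | true = contradiction refl (proj₁ (lollipop⁻ g {i} {i} eq))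

-- A missed value together with the n images would give n + 1 distinct elements of `Fin n`.
injective⇒surjective : ∀ {n} (f : Fin n → Fin n) → (∀ {u v} → f u ≡ f v → u ≡ v) → ∀ w → ∃ λ v → f v ≡ w
injective⇒surjective {n} f inj w with w ∈? map f (allFin n)
... | yes w∈ with ∈-map⁻ f w∈
... | v , _ , eq = v , sym eq
injective⇒surjective {n} f inj w | no w∉ = contradiction
  (length-⊆ (All.tabulate (λ { x∈ refl → w∉ x∈ }) ∷ UniqueP.map⁺ inj (UniqueP.allFin⁺ n)) (λ {x} _ → ∈-allFin x))
  (<⇒≱ (≤-reflexive (cong suc (sym (length-map f (allFin n))))))

module _ {n g} {p : Fin n → Fin n} (chain : Chain g p) where
  open Chain chain

  chain-adj⁺ : ∀ {i} → p i ≢ i → LolliAdj g (h i) (h (p i))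
  chain-adj⁺ {i} pi≢i with h i in eq
  ... | zero = (λ e → pi≢i (h-inj (trans (sym e) (sym eq)))) , inj₂ (inj₂ (inj₁ (refl , h-zero eq)))
  ... | suc k = (λ e → pi≢i (h-inj (trans (sym e) (sym eq)))) , inj₂ (inj₁ (cong suc (h-suc eq)))

  chain-adj⁻ : ∀ {i j} → LolliAdj g (h i) (h j) → p i ≡ j ⊎ p j ≡ i
  chain-adj⁻ (_ , inj₁ eq) = inj₂ (h-inj (h-suc (sym eq)))
  chain-adj⁻ (_ , inj₂ (inj₁ eq)) = inj₁ (h-inj (h-suc (sym eq)))
  chain-adj⁻ (_ , inj₂ (inj₂ (inj₁ (hi , hj)))) = inj₁ (h-inj (trans (h-zero hi) (sym hj)))
  chain-adj⁻ (_ , inj₂ (inj₂ (inj₂ (hj , hi)))) = inj₂ (h-inj (trans (h-zero hj) (sym hi)))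

  chain-≅ : ∀ {G : Graph n} → IsSimple G → Represents G p → G ≅ lollipop n g
  chain-≅ {G} simple rep = mk↔ₛ′ f (proj₁ ∘ onto) (λ w → proj₂ (onto w)) (λ v → f-inj (proj₂ (onto (f v)))) , adjacency
    where
    open Represents rep
    f : Fin n → Fin n
    f v = fromℕ< (h<n v)
    toℕ-f : ∀ v → toℕ (f v) ≡ h v
    toℕ-f v = toℕ-fromℕ< (h<n v)
    f-inj : ∀ {u v} → f u ≡ f v → u ≡ v
    f-inj {u} {v} eq = h-inj (trans (sym (toℕ-f u)) (trans (cong toℕ eq) (toℕ-f v)))
    onto : ∀ w → ∃ λ v → f v ≡ w
    onto = injective⇒surjective f f-inj
    adjacent : ∀ {i j} → G i j ≡ true → LolliAdj g (h i) (h j)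
    adjacent {i} {j} adj with adj-arc adj
    ... | inj₁ refl = chain-adj⁺ (no-fixpoint i)
    ... | inj₂ refl = lolli-sym g (chain-adj⁺ (no-fixpoint j))
    adjacent⁻ : ∀ {i j} → LolliAdj g (h i) (h j) → G i j ≡ true
    adjacent⁻ {i} {j} l with chain-adj⁻ l
    ... | inj₁ refl = arc-adj i
    ... | inj₂ refl = trans (proj₁ simple _ _) (arc-adj j)
    adjacency : ∀ i j → G i j ≡ lollipop n g (f i) (f j)
    adjacency i j = ⇔-true
      (λ adj → lollipop⁺ g (subst₂ (LolliAdj g) (sym (toℕ-f i)) (sym (toℕ-f j)) (adjacent adj)))
      (λ adj → adjacent⁻ (subst₂ (LolliAdj g) (toℕ-f i) (toℕ-f j) (lollipop⁻ g adj)))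

  -- The first step from height 0 goes up to g - 1 and the others descend. For 0 < k < g the height
  -- after k steps is g - k, so the return takes exactly g steps.
  chain-Rho : 3 ≤ g → g < n → Rho g p
  chain-Rho 3≤g g<n = record
    { o = bottom ; 3≤g = 3≤g ; period = period ; minimal = minimal ; reaches = λ v → h v , descend (h v) refl }
    where
    0<g : 0 < g
    0<g = ≤-trans (s≤s z≤n) 3≤g
    bottom : Fin n
    bottom = proj₁ (h-surj (<-trans 0<g g<n))
    h-bottom : h bottom ≡ 0
    h-bottom = proj₂ (h-surj (<-trans 0<g g<n))
    descend : ∀ k {v} → h v ≡ k → iter k p v ≡ bottom
    descend zero eq = h-inj (trans eq (sym h-bottom))
    descend (suc k) {v} eq = trans (iter-comm p 1 k v) (descend k (h-suc eq))
    h-iter : ∀ k {v m} → h v ≡ k + m → h (iter k p v) ≡ m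
    h-iter zero eq = eq
    h-iter (suc k) {v} eq = trans (cong h (iter-comm p 1 k v)) (h-iter k (h-suc eq))
    around : ∀ {k} → 0 < k → iter k p bottom ≡ iter (k ∸ 1) p (p bottom)
    around {suc k} _ = iter-comm p 1 k bottom
    period : iter g p bottom ≡ bottom
    period = trans (around 0<g) (descend (g ∸ 1) (h-zero h-bottom))
    minimal : ∀ {k} → 0 < k → k < g → iter k p bottom ≢ bottom
    minimal {k} 0<k k<g eq = <⇒≢ (m<n⇒0<n∸m k<g) (begin
      0                                ≡⟨ h-bottom ⟨
      h bottom                         ≡⟨ cong h eq ⟨
      h (iter k p bottom)              ≡⟨ cong h (around 0<k) ⟩
      h (iter (k ∸ 1) p (p bottom))    ≡⟨ h-iter (k ∸ 1) (trans (h-zero h-bottom) (split 0<k k<g)) ⟩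
      g ∸ k                            ∎)
      where
      open ≡-Reasoning
      split : ∀ {k g} → 0 < k → k < g → g ∸ 1 ≡ k ∸ 1 + (g ∸ k)
      split {suc k} {suc g} _ (s≤s k<g) = sym (m+[n∸m]≡n (<⇒≤ k<g))

-- The function and the numbering are pulled back from the lollipop, where p is the predecessor and
-- sends 0 to g - 1.
≅⇒chain : ∀ {n g} {G : Graph n} → 3 ≤ g → g < n → G ≅ lollipop n g →
  ∃ λ p → Chain g p × Rho g p × Represents G p
≅⇒chain {n} {g} {G} 3≤g g<n (f , adj) = p , chain , ρ , record
  { arc-adj = λ v → trans (adj v (p v)) (lollipop⁺ g (chain-adj⁺ chain (fixpoint-free v)))
  ; adj-arc = λ {i} {j} a → chain-adj⁻ chain (lollipop⁻ g (trans (sym (adj i j)) a))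
  ; no-2-cycle = Orbits.no-2-cycle ρ
  }
  where
  open Inverse f
  g∸1<n : g ∸ 1 < n
  g∸1<n = ≤-<-trans (m∸n≤m g 1) g<n
  down : ∀ w → ∃ λ x → (toℕ w ≡ 0 → toℕ x ≡ g ∸ 1) × (∀ {k} → toℕ w ≡ suc k → toℕ x ≡ k)
  down zero = fromℕ< g∸1<n , (λ _ → toℕ-fromℕ< g∸1<n) , λ ()
  down (suc w) = inject₁ w , (λ ()) , λ { refl → toℕ-inject₁ w }
  p : Fin n → Fin n
  p v = from (proj₁ (down (to v)))
  h-p : ∀ v → toℕ (to (p v)) ≡ toℕ (proj₁ (down (to v)))
  h-p v = cong toℕ (strictlyInverseˡ _)
  chain : Chain g p
  chain = record
    { h = toℕ ∘ to
    ; h<n = λ v → toℕ<n (to v)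
    ; h-inj = λ {u} {v} eq → trans (sym (strictlyInverseʳ u)) (trans (cong from (toℕ-injective eq)) (strictlyInverseʳ v))
    ; h-surj = λ k<n → from (fromℕ< k<n) , trans (cong toℕ (strictlyInverseˡ _)) (toℕ-fromℕ< k<n)
    ; h-suc = λ {v} eq → trans (h-p v) (proj₂ (proj₂ (down (to v))) eq)
    ; h-zero = λ {v} eq → trans (h-p v) (proj₁ (proj₂ (down (to v))) eq)
    }
  ρ : Rho g p
  ρ = chain-Rho chain 3≤g g<n
  fixpoint-free : ∀ v → p v ≢ v
  fixpoint-free v eq = Orbits.no-2-cycle ρ v (trans (cong p eq) eq)

module _ {n g} {p : Fin n → Fin n} (ρ : Rho g p) where
  open Orbits ρ

  -- The pendant path leaves the cycle at p o, so the distance to o numbers the vertices as in the lollipop.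
  comparable⇒chain : ∀ {x} → ¬ Cyclic x → p x ≡ p o →
    (∀ {u v} → ¬ Cyclic u → ¬ Cyclic v → u ≼ v ⊎ v ≼ u) → Chain g p
  comparable⇒chain {x} x-off px≡po total = record
    { h = h ; h<n = h<n ; h-inj = h-inj
    ; h-surj = λ k<n → map₂ (λ {v} eq → trans (sym (toℕ-fromℕ< (h<n v))) (trans (cong toℕ eq) (toℕ-fromℕ< k<n)))
        (injective⇒surjective (λ v → fromℕ< (h<n v))
          (λ {u} {v} eq → h-inj (trans (sym (toℕ-fromℕ< (h<n u))) (trans (cong toℕ eq) (toℕ-fromℕ< (h<n v)))))
          (fromℕ< k<n))
    ; h-suc = λ {v} eq → suc-injective (trans (sym (h-step (λ { refl → contradiction (trans (sym h-o) eq) λ () }))) eq)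
    ; h-zero = λ {v} eq → trans (cong (h ∘ p) (h≡0 eq)) h-po
    }
    where
    nearest : ∀ v → ∃ λ k → iter k p v ≡ o × (∀ {j} → j < k → iter j p v ≢ o)
    nearest v = least (λ k → iter k p v ≟ o) (proj₁ (reaches v)) (proj₂ (reaches v))
    h : Fin n → ℕ
    h v = proj₁ (nearest v)
    arrives : ∀ v → iter (h v) p v ≡ o
    arrives v = proj₁ (proj₂ (nearest v))
    h-≤ : ∀ {v k} → iter k p v ≡ o → h v ≤ k
    h-≤ {v} eq = ≮⇒≥ λ k<h → proj₂ (proj₂ (nearest v)) k<h eq
    h≡0 : ∀ {v} → h v ≡ 0 → v ≡ o
    h≡0 {v} eq = trans (cong (λ k → iter k p v) (sym eq)) (arrives v)
    h-o : h o ≡ 0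
    h-o = n≤0⇒n≡0 (h-≤ {o} {0} refl)
    h-step : ∀ {v} → v ≢ o → h v ≡ suc (h (p v))
    h-step {v} v≢o = ≤-antisym (h-≤ (trans (iter-comm p 1 (h (p v)) v) (arrives (p v)))) (later (h v) refl)
      where
      later : ∀ k → h v ≡ k → suc (h (p v)) ≤ h v
      later zero eq = contradiction (h≡0 eq) v≢o
      later (suc k) eq = subst (suc (h (p v)) ≤_) (sym eq) (s≤s (h-≤ {p v} {k}
        (trans (sym (iter-comm p 1 k v)) (trans (cong (λ m → iter m p v) (sym eq)) (arrives v)))))
    h-po : h (p o) ≡ g ∸ 1
    h-po = ≤-antisym (h-≤ (trans (sym (iter-comm p 1 (g ∸ 1) o)) (trans (cong (λ k → iter k p o) (m+[n∸m]≡n 0<g)) period)))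
      (≮⇒≥ λ h< → minimal {suc (h (p o))} (s≤s z≤n) (subst (suc (h (p o)) <_) (m+[n∸m]≡n 0<g) (s≤s h<))
        (trans (iter-comm p 1 (h (p o)) o) (arrives (p o))))
    -- On the cycle h counts the steps still missing to `o`, so v is found g - h v steps after `o`.
    h-cyclic : ∀ {v} → Cyclic v → v ≡ iter (g ∸ h v) p o × h v < g
    h-cyclic {v} c with cyclic-index c
    ... | zero , _ , refl rewrite h-o = sym period , 0<g
    ... | suc i , i<g , refl = back , h<g
      where
      h<g : h (iter (suc i) p o) < g
      h<g = ≤-<-trans (h-≤ (trans (sym (iter-∸ p o (<⇒≤ i<g))) period)) (∸-monoʳ-< (s≤s z≤n) (<⇒≤ i<g))
      back : iter (suc i) p o ≡ iter (g ∸ h (iter (suc i) p o)) p o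
      back = trans (sym (cyclic-period (suc i , refl)))
        (trans (iter-∸ p _ (<⇒≤ h<g)) (cong (iter (g ∸ h (iter (suc i) p o)) p) (arrives _)))
    h-tail : ∀ k {v} → ¬ Cyclic (iter k p v) → h v ≡ k + h (iter k p v)
    h-tail zero _ = refl
    h-tail (suc k) {v} off = trans (h-step (λ { refl → off (suc k , refl) }))
      (cong suc (trans (h-tail k (subst (¬_ ∘ Cyclic) (iter-comm p 1 k v) off))
        (cong (λ w → k + h w) (sym (iter-comm p 1 k v)))))
    h-x : h x ≡ g
    h-x = trans (h-step (λ { refl → x-off (⊑-refl p) })) (trans (cong (suc ∘ h) px≡po) (trans (cong suc h-po) (m+[n∸m]≡n 0<g)))
    h-off : ∀ {v} → ¬ Cyclic v → g ≤ h v
    h-off {v} off with total off x-off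
    ... | inj₁ (k , refl) = subst (g ≤_) (sym (trans (h-tail k x-off) (cong (k +_) h-x))) (m≤n+m g k)
    ... | inj₂ (zero , refl) = ≤-reflexive (sym h-x)
    -- A proper successor of x lies on the orbit of p x = p o, hence on the cycle.
    ... | inj₂ (suc k , refl) = contradiction (subst Cyclic (sym (iter-comm p 1 k x))
        (⊑-trans p (cyclic-p (⊑-refl p)) (subst (_≼ iter k p (p x)) px≡po (k , refl)))) off
    h-off-inj : ∀ {u v} → ¬ Cyclic v → u ≼ v → h u ≡ h v → u ≡ v
    h-off-inj _ (zero , eq) _ = eq
    h-off-inj off (suc k , refl) eq = contradiction (trans (sym eq) (h-tail (suc k) off)) (<⇒≢ (m<n+m _ (s≤s z≤n)))
    h-inj : ∀ {u v} → h u ≡ h v → u ≡ v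
    h-inj {u} {v} eq with cyclic? u | cyclic? v
    ... | yes cu | yes cv = trans (proj₁ (h-cyclic cu)) (trans (cong (λ k → iter (g ∸ k) p o) eq) (sym (proj₁ (h-cyclic cv))))
    ... | yes cu | no ov = contradiction (h-off ov) (<⇒≱ (subst (_< g) eq (proj₂ (h-cyclic cu))))
    ... | no ou | yes cv = contradiction (h-off ou) (<⇒≱ (subst (_< g) (sym eq) (proj₂ (h-cyclic cv))))
    ... | no ou | no ov with total ou ov
    ... | inj₁ u≼v = h-off-inj ov u≼v eq
    ... | inj₂ v≼u = sym (h-off-inj ou v≼u (sym eq))
    h-iter : ∀ v j → j ≤ h v → h (iter j p v) ≡ h v ∸ j
    h-iter v zero _ = refl
    h-iter v (suc j) j<h = suc-injective (trans (sym (h-step ≢o)) (trans (h-iter v j (<⇒≤ j<h)) (+-∸-assoc 1 j<h)))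
      where
      ≢o : iter j p v ≢ o
      ≢o eq = proj₂ (proj₂ (nearest v)) j<h eq
    -- The h v + 1 vertices v, p v, ..., `o` have different heights and are therefore distinct.
    h<n : ∀ v → h v < n
    h<n v = injective⇒≤ {f = λ (j : Fin (suc (h v))) → iter (toℕ j) p v} λ {i} {j} eq → toℕ-injective
      (∸-cancelˡ-≡ (bound i) (bound j) (trans (sym (h-iter v (toℕ i) (bound i))) (trans (cong h eq) (h-iter v (toℕ j) (bound j)))))
      where
      bound : ∀ (i : Fin (suc (h v))) → toℕ i ≤ h v
      bound i = ≤-pred (toℕ<n i)

-- The function of a unicyclic graph

module _ {n g} {G : Graph n} (simple : IsSimple G) (unicyclic : Unicyclic G) (hasCycle : HasCycle G g) where

  private
    3≤g : 3 ≤ g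
    3≤g = proj₁ hasCycle

    0<g : 0 < g
    0<g = ≤-trans (s≤s z≤n) 3≤g

    c : Fin g → Fin n
    c = proj₁ (proj₂ hasCycle)

    c-injective : ∀ {i j} → c i ≡ c j → i ≡ j
    c-injective = proj₁ (proj₂ (proj₂ hasCycle))

    OnCycle : Fin n → Set
    OnCycle v = ∃ λ i → c i ≡ v

    first : Fin g
    first = fromℕ< 0<g

    successor : ∀ i → ∃ λ j → suc (toℕ i) ≡ toℕ j ⊎ (toℕ i ≡ g ∸ 1 × toℕ j ≡ 0)
    successor i with suc (toℕ i) <? g
    ... | yes lt = fromℕ< lt , inj₁ (sym (toℕ-fromℕ< lt))
    ... | no ≮ = first , inj₂ (cong (_∸ 1) (≤-antisym (toℕ<n i) (≮⇒≥ ≮)) , toℕ-fromℕ< 0<g)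

    next : Fin g → Fin g
    next i = proj₁ (successor i)

    cycle-edge : ∀ i → G (c i) (c (next i)) ≡ true
    cycle-edge i with successor i
    ... | j , inj₁ eq = proj₁ (proj₂ (proj₂ (proj₂ hasCycle))) i j eq
    ... | j , inj₂ (last , start) = proj₂ (proj₂ (proj₂ (proj₂ hasCycle))) i j last start

    -- Distance at most k from the cycle, in a cumulative and decidable form from which `least`
    -- extracts the distance.
    Near : ℕ → Fin n → Set
    Near zero v = OnCycle v
    Near (suc k) v = Near k v ⊎ ∃ λ u → G v u ≡ true × Near k u

    near? : ∀ k → Decidable (Near k)
    near? zero v = any? (λ i → c i ≟ v)
    near? (suc k) v = near? k v ⊎-dec any? (λ u → (G v u ≟ᵇ true) ×-dec near? k u)

    -- Having some finite distance to the cycle passes along every edge in both directions, so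
    -- connectedness spreads it from a vertex of the cycle.
    near : ∀ v → ∃ λ k → Near k v
    near v = proj₂ (proj₂ (connectedSub⁻ {V = replicate n true} {edges G} (proj₁ unicyclic))) {λ v → ∃ λ k → Near k v}
      (λ {a} {b} e∈ → (λ { (k , d) → suc k , inj₂ (a , trans (proj₁ simple b a) (proj₂ (∈-edges⁻ G e∈)) , d) }) ,
                      (λ { (k , d) → suc k , inj₂ (b , proj₂ (∈-edges⁻ G e∈) , d) }))
      {c first} {v} (lookup-replicate (c first) true) (lookup-replicate v true) (0 , first , refl)

    closest : ∀ v → ∃ λ k → Near k v × (∀ {j} → j < k → ¬ Near j v)
    closest v = least (λ k → near? k v) (proj₁ (near v)) (proj₂ (near v))

    level : Fin n → ℕ
    level v = proj₁ (closest v)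

    level-≤ : ∀ {k v} → Near k v → level v ≤ k
    level-≤ {v = v} d = ≮⇒≥ λ k< → proj₂ (proj₂ (closest v)) k< d

    choose : ∀ v → ∃ λ w → G v w ≡ true × (∀ i → c i ≡ v → w ≡ c (next i)) × (¬ OnCycle v → level w < level v)
    choose v with any? (λ i → c i ≟ v)
    ... | yes (i , refl) = c (next i) , cycle-edge i , (λ j eq → cong (c ∘ next) (sym (c-injective eq))) , (λ ¬on → contradiction (i , refl) ¬on)
    ... | no ¬on with closest v
    ... | zero , on , _ = contradiction on ¬on
    -- At the least distance the first alternative is excluded, and the second supplies a neighbour
    -- nearer to the cycle.
    ... | suc k , inj₁ d , below = contradiction d (below (n<1+n k))
    ... | suc k , inj₂ (u , adj , d) , _ = u , adj , (λ i eq → contradiction (i , eq) ¬on) , (λ _ → s≤s (level-≤ d))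

    p : Fin n → Fin n
    p v = proj₁ (choose v)

    p-adj : ∀ v → G v (p v) ≡ true
    p-adj v = proj₁ (proj₂ (choose v))

    p-cycle : ∀ i → p (c i) ≡ c (next i)
    p-cycle i = proj₁ (proj₂ (proj₂ (choose (c i)))) i refl

    p-level : ∀ {v} → ¬ OnCycle v → level (p v) < level v
    p-level {v} = proj₂ (proj₂ (proj₂ (choose v)))

    iter-first : ∀ k (k<g : k < g) → iter k p (c first) ≡ c (fromℕ< k<g)
    iter-first zero k<g = cong c (toℕ-injective (trans (toℕ-fromℕ< 0<g) (sym (toℕ-fromℕ< k<g))))
    iter-first (suc k) k<g = trans (cong p (iter-first k (<⇒≤ k<g))) (trans (p-cycle _) (cong c (toℕ-injective step-k)))
      where
      step-k : toℕ (next (fromℕ< (<⇒≤ k<g))) ≡ toℕ (fromℕ< k<g)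
      step-k with successor (fromℕ< (<⇒≤ k<g))
      ... | j , inj₁ eq = trans (sym eq) (trans (cong suc (toℕ-fromℕ< (<⇒≤ k<g))) (sym (toℕ-fromℕ< k<g)))
      ... | j , inj₂ (last , _) = contradiction (trans (sym (toℕ-fromℕ< (<⇒≤ k<g))) last) (<⇒≢ (∸-monoˡ-≤ 1 k<g))

    period : iter g p (c first) ≡ c first
    period = subst (λ k → iter k p (c first) ≡ c first) (m+[n∸m]≡n 0<g)
      (trans (cong p (iter-first (g ∸ 1) last<)) (trans (p-cycle _) (cong c (toℕ-injective wrap))))
      where
      last< : g ∸ 1 < g
      last< = ∸-monoʳ-< (s≤s z≤n) 0<g
      wrap : toℕ (next (fromℕ< last<)) ≡ toℕ first
      wrap with successor (fromℕ< last<)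
      ... | j , inj₁ eq = contradiction (toℕ<n j) (≤⇒≯ (≤-reflexive
        (trans (sym (m+[n∸m]≡n 0<g)) (trans (cong suc (sym (toℕ-fromℕ< last<))) eq))))
      ... | j , inj₂ (_ , start) = trans start (sym (toℕ-fromℕ< 0<g))

    c-iter : ∀ i → iter (toℕ i) p (c first) ≡ c i
    c-iter i = trans (iter-first (toℕ i) (toℕ<n i)) (cong c (fromℕ<-toℕ i (toℕ<n i)))

    -- The level drops until the cycle is met; from its position i another g - i steps lead to
    -- position 0.
    reaches : ∀ v → ∃ λ k → iter k p v ≡ c first
    reaches v = <-rec (λ l → ∀ v → level v ≡ l → ∃ λ k → iter k p v ≡ c first) descend (level v) v refl
      where
      descend : ∀ l → (∀ {l′} → l′ < l → ∀ v → level v ≡ l′ → ∃ λ k → iter k p v ≡ c first) →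
        ∀ v → level v ≡ l → ∃ λ k → iter k p v ≡ c first
      descend l rec v refl with any? (λ i → c i ≟ v)
      ... | yes (i , refl) = g ∸ toℕ i , trans (cong (iter (g ∸ toℕ i) p) (sym (c-iter i)))
        (trans (sym (iter-∸ p (c first) (<⇒≤ (toℕ<n i)))) period)
      ... | no ¬on with rec (p-level ¬on) (p v) refl
      ... | k , eq = suc k , trans (iter-comm p 1 k v) eq

    ρ : Rho g p
    ρ = record
      { o = c first ; 3≤g = 3≤g ; period = period ; reaches = reaches
      ; minimal = λ {k} 0<k k<g eq → <⇒≢ 0<k (trans (sym (toℕ-fromℕ< 0<g))
          (trans (cong toℕ (c-injective (trans (sym eq) (iter-first k k<g)))) (toℕ-fromℕ< k<g)))
      }

    no-2-cycle : ∀ v → p (p v) ≢ v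
    no-2-cycle = Orbits.no-2-cycle ρ

    arc : ∀ v → ∃ λ e → e ∈ edges G × (e ≡ (v , p v) ⊎ e ≡ (p v , v))
    arc = orient simple p-adj (λ v eq → no-2-cycle v (trans (cong p eq) eq))

    arcs : List (Fin n × Fin n)
    arcs = map (λ v → proj₁ (arc v)) (allFin n)

    arc-injective : ∀ {u v} → proj₁ (arc u) ≡ proj₁ (arc v) → u ≡ v
    arc-injective {u} {v} eq with arc u | arc v
    ... | _ , _ , inj₁ refl | _ , _ , inj₁ refl = cong proj₁ eq
    ... | _ , _ , inj₂ refl | _ , _ , inj₂ refl = cong proj₂ eq
    ... | _ , _ , inj₁ refl | _ , _ , inj₂ refl =
      contradiction (trans (cong p (sym (cong proj₁ eq))) (cong proj₂ eq)) (no-2-cycle v)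
    ... | _ , _ , inj₂ refl | _ , _ , inj₁ refl =
      contradiction (trans (cong p (cong proj₁ eq)) (sym (cong proj₂ eq))) (no-2-cycle u)

    -- n distinct edges {v , p v} exhaust the n edges of G.
    edge-arc : ∀ {i j} → (i , j) ∈ edges G → p i ≡ j ⊎ p j ≡ i
    edge-arc {i} {j} e∈ with DecMembership._∈?_ (ProductP.≡-dec _≟_ _≟_) (i , j) arcs
    ... | yes e∈arcs with ∈-map⁻ (λ v → proj₁ (arc v)) e∈arcs
    ... | v , _ , eq with arc v
    ... | _ , _ , inj₁ refl = inj₁ (trans (cong (p ∘ proj₁) eq) (sym (cong proj₂ eq)))
    ... | _ , _ , inj₂ refl = inj₂ (trans (cong (p ∘ proj₂) eq) (sym (cong proj₁ eq)))
    edge-arc {i} {j} e∈ | no e∉ = contradiction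
      (length-⊆ (All.tabulate (λ { x∈ refl → e∉ x∈ }) ∷ UniqueP.map⁺ arc-injective (UniqueP.allFin⁺ n)) listed)
      (<⇒≱ (≤-reflexive (cong suc (trans (proj₂ unicyclic)
        (sym (trans (length-map (λ v → proj₁ (arc v)) (allFin n)) (length-tabulate id)))))))
      where
      listed : ∀ {e} → e ∈ (i , j) ∷ arcs → e ∈ edges G
      listed (here refl) = e∈
      listed (there e∈′) with ∈-map⁻ (λ v → proj₁ (arc v)) e∈′
      ... | v , _ , refl = proj₁ (proj₂ (arc v))

    adj-arc : ∀ {i j} → G i j ≡ true → p i ≡ j ⊎ p j ≡ i
    adj-arc {i} {j} adj with <-cmp (toℕ i) (toℕ j)
    ... | tri< i<j _ _ = edge-arc (∈-edges⁺ G i<j adj)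
    ... | tri> _ _ j<i with edge-arc (∈-edges⁺ G j<i (trans (proj₁ simple j i) adj))
    ... | inj₁ eq = inj₂ eq
    ... | inj₂ eq = inj₁ eq
    adj-arc {i} {j} adj | tri≈ _ i≡j _ with toℕ-injective i≡j
    ... | refl = contradiction (trans (sym adj) (proj₂ simple i)) λ ()

  unicyclic-function : ∃ λ p → Rho g p × Represents G p
  unicyclic-function = p , ρ , record { arc-adj = p-adj ; adj-arc = adj-arc ; no-2-cycle = no-2-cycle }

-- The value for lollipops and the equality case.

≅-lollipop⇒F : ∀ {n g} {G : Graph n} → 3 ≤ g → g < n → IsSimple G → G ≅ lollipop n g →
  2 * F G ≡ (n ∸ g) * (n + g * g + 3) + 2 * (g * g + 1)
≅-lollipop⇒F 3≤g g<n simple iso with ≅⇒chain 3≤g g<n iso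
-- The transported numbering makes both bounds available for G, and they coincide.
... | p , chain , ρ , rep = ≤-antisym
  (UpperBound.upper-bound simple rep (≤-trans (s≤s z≤n) 3≤g) g<n chain) (LowerBound.lower-bound simple rep ρ)

F-lollipop : ∀ {n g} → 3 ≤ g → g < n → 2 * F (lollipop n g) ≡ (n ∸ g) * (n + g * g + 3) + 2 * (g * g + 1)
F-lollipop {n} {g} 3≤g g<n = ≅-lollipop⇒F 3≤g g<n (lollipop-simple n g) (↔-id _ , λ _ _ → refl)

module _ {n g} {p : Fin n → Fin n} (ρ : Rho g p) (g<n : g < n) where
  open Orbits ρ

  -- Since g < n there is a tail; x is the last vertex of its orbit before the entry point.
  attachment : ∃ λ x → ¬ Cyclic x × Cyclic (p x)
  attachment with off in eq
  ... | [] = contradiction (trans (sym (cong (g +_) (cong length eq))) length-off) (<⇒≢ (subst (_< n) (sym (+-identityʳ g)) g<n))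
  ... | u ∷ _ = entered (depth u) refl
    where
    entered : ∀ k → depth u ≡ k → ∃ λ x → ¬ Cyclic x × Cyclic (p x)
    entered zero d = contradiction (subst (λ k → Cyclic (iter k p u)) d (depth-cyclic u)) (∈-off⁻ (subst (u ∈_) (sym eq) (here refl)))
    entered (suc k) d = iter k p u , depth-minimal u (subst (k <_) (sym d) (n<1+n k)) , subst (λ k → Cyclic (iter k p u)) d (depth-cyclic u)

  -- The base point moves to the cyclic predecessor of p x, found by going g - 1 steps round from p
  -- x. Then the tail leaves the cycle at p o, as the numbering by distance to the base point
  -- requires.
  rerooted : Σ (Rho g p) λ ρ′ → ∃ λ x → ¬ Orbits.Cyclic ρ′ x × p x ≡ p (Rho.o ρ′)
  rerooted with attachment
  ... | x , x-off , px-cyclic = rotate o′-cyclic , x , (λ o′≼x → x-off (⊑-trans p o′-cyclic o′≼x)) , (begin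
    p x                          ≡⟨ cyclic-period px-cyclic ⟨
    iter g p (p x)               ≡⟨ cong (λ k → iter k p (p x)) (m+[n∸m]≡n 0<g) ⟨
    p (iter (g ∸ 1) p (p x))     ∎)
    where
    open ≡-Reasoning
    o′-cyclic : Cyclic (iter (g ∸ 1) p (p x))
    o′-cyclic = ⊑-trans p px-cyclic (g ∸ 1 , refl)

-- Comparability decides between the alternatives. It may be tested on all vertices, since a cyclic
-- vertex is comparable with every other.
≅-or-larger : ∀ {n g} {G : Graph n} → g < n → IsSimple G → Unicyclic G → HasCycle G g →
  G ≅ lollipop n g ⊎ (n ∸ g) * (n + g * g + 3) + 2 * (g * g + 1) < 2 * F G
≅-or-larger {n} {g} g<n simple uni hasCycle with unicyclic-function simple uni hasCycle
... | p , ρ₀ , rep with rerooted ρ₀ g<n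
... | ρ , x , x-off , px≡po
  with any? (λ u → any? (λ v → ¬? (Orbits._≼?_ ρ u v) ×-dec ¬? (Orbits._≼?_ ρ v u)))
... | yes (u , v , u⋠v , v⋠u) = inj₂ (LowerBound.strict-lower-bound simple rep ρ u⋠v v⋠u)
... | no none = inj₁ (chain-≅ (comparable⇒chain ρ x-off px≡po (λ {u} {v} _ _ → total u v)) simple rep)
  where
  open Orbits ρ
  total : ∀ u v → u ≼ v ⊎ v ≼ u
  total u v with u ≼? v | v ≼? u
  ... | yes u≼v | _ = inj₁ u≼v
  ... | no _ | yes v≼u = inj₂ v≼u
  ... | no u⋠v | no v⋠u = contradiction (u , v , u⋠v , v⋠u) none

theorem4p8 : (n g : ℕ) → 3 ≤ g → g < n → (G : Graph n) → IsSimple G →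
    Unicyclic G → Girth G g →
    (F (lollipop n g) ≤ F G)
    × ((F G ≡ F (lollipop n g)) ⇔ (G ≅ lollipop n g))
    × (2 * F (lollipop n g) ≡ (n ∸ g) * (n + g * g + 3) + 2 * (g * g + 1))
theorem4p8 n g 3≤g g<n G simple uni (hasCycle , _) with ≅-or-larger g<n simple uni hasCycle
... | inj₁ iso = ≤-reflexive (sym F≡) , mk⇔ (λ _ → iso) (λ _ → F≡) , F-lollipop 3≤g g<n
  where
  F≡ : F G ≡ F (lollipop n g)
  F≡ = *-cancelˡ-≡ _ _ 2 (trans (≅-lollipop⇒F 3≤g g<n simple iso) (sym (F-lollipop 3≤g g<n)))
-- An isomorphism would give G the lollipop value, against `larger`.
... | inj₂ larger = <⇒≤ F< , mk⇔ (λ eq → contradiction (sym eq) (<⇒≢ F<))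
    (λ iso → contradiction (sym (≅-lollipop⇒F 3≤g g<n simple iso)) (<⇒≢ larger)) , F-lollipop 3≤g g<n
  where
  F< : F (lollipop n g) < F G
  F< = *-cancelˡ-< 2 _ _ (subst (_< 2 * F G) (sym (F-lollipop 3≤g g<n)) larger)
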